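{- Let $\tau>0$ and $c\geq 0$ be constants independent of $n$ and $q$. Suppose that for all constants $q$ (positive integers) there exists a trilinear algorithm for $\Delta(f,g,h)$, on inputs $f,g,h:\binom{U}{q}\to\mathbb{Z}$ over an $n$-element set $U$, with rank $r=O\bigl(n^{3q(1/2-\tau)+c}\bigr)$ over the integers. Then $\omega\leq 3-\tau$.
   Context: $\binom{U}{q}$ denotes the set of all $q$-element subsets of $U$, and $$\Delta(f,g,h)=\sum_{\substack{A,B,C\in\binom{U}{q}\\ A\cap B=A\cap C=B\cap C=\emptyset}} f(A)\,g(B)\,h(C).$$ A trilinear algorithm of rank $r$ over the integers for $\Delta$ (for given $q$ and $n$) consists of coefficients $\lambda_s,\alpha_{s,A},\beta_{s,B},\gamma_{s,C}\in\mathbb{Z}$ for $s=1,\ldots,r$ and $A,B,C\in\binom{U}{q}$ such that, for all $f,g,h$, $$\Delta(f,g,h)=\sum_{s=1}^r\lambda_s\Bigl(\sum_{A\in\binom{U}{q}}\alpha_{s,A}f(A)\Bigr)\Bigl(\sum_{B\in\binom{U}{q}}\beta_{s,B}\,g(B)\Bigr)\Bigl(\sum_{C\in\binom{U}{q}}\gamma_{s,C}h(C)\Bigr).$$ The hypothesis means that for each fixed $q$ such algorithms exist for every $n$, with rank $r=r(n)$ satisfying the stated bound as $n\to\infty$ (the hidden constant may depend on $q$). $\omega$ is the limiting exponent of square matrix multiplication: the infimum of the reals $w$ such that two $N\times N$ integer matrices can be multiplied using $O(N^{w})$ arithmetic operations (addition, subtraction, multiplication, and exact division of integers). -}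

module Defs where

open import Data.Nat.Base as ℕ using (ℕ; zero; suc)
import Data.Nat.Properties as ℕ
open import Data.Integer.Base as ℤ using (ℤ; +_; 0ℤ)
open import Data.Rational.Base as ℚ using (ℚ; 0ℚ; 1ℚ; ½; ↥_; ↧ₙ_)
import Data.Rational.Properties as ℚ
open import Data.Rational.Solver using (module +-*-Solver)
open import Data.Empty using (⊥)
open import Data.Fin.Base using (Fin)
open import Data.Fin.Subset using (Subset; inside; outside; ∣_∣; _∩_; Empty)
open import Data.Fin.Subset.Properties using (nonempty?)
open import Data.List.Base
  using (List; []; _∷_; _++_; map; foldr; filter; allFin; cartesianProduct)
open import Data.List.Membership.Propositional using (_∈_)
open import Data.List.Membership.Propositional.Properties
  using (∈-map⁺; ∈-map⁻; ∈-++⁺ˡ; ∈-++⁺ʳ)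
open import Data.List.Relation.Unary.All using ([])
open import Data.List.Relation.Unary.Any using (here)
open import Data.List.Relation.Unary.Unique.Propositional using (Unique; []; _∷_)
import Data.List.Relation.Unary.Unique.Propositional.Properties as Unique
open import Data.Product.Base using (∃; _×_; _,_; proj₁)
open import Data.Sum.Base using (_⊎_; inj₁; inj₂)
open import Data.Vec.Base as Vec using ([]; _∷_)
open import Data.Vec.Properties using (∷-injectiveʳ)
open import Level using (0ℓ)
open import Relation.Binary.PropositionalEquality
  using (_≡_; _≢_; refl; sym; trans; cong; subst)
open import Relation.Nullary.Decidable using (¬?; _×-dec_)
open import Relation.Unary using (Pred; Decidable)

------------------------------------------------------------------------

record ℝ : Set where
  field
    seq    : ℕ → ℚ
    cauchy : ∀ ε → 0ℚ ℚ.< ε → ∃ λ N → ∀ m n → N ℕ.≤ m → N ℕ.≤ n →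
             ℚ.∣ seq m ℚ.- seq n ∣ ℚ.< ε

open ℝ public

module _ where
  open +-*-Solver

  private
    half+half : ∀ ε → ½ ℚ.* ε ℚ.+ ½ ℚ.* ε ≡ ε
    half+half ε = trans (sym (ℚ.*-distribʳ-+ ε ½ ½)) (ℚ.*-identityˡ ε)

    half-pos : ∀ {ε} → 0ℚ ℚ.< ε → 0ℚ ℚ.< ½ ℚ.* ε
    half-pos {ε} 0<ε =
      subst (ℚ._< ½ ℚ.* ε) (ℚ.*-zeroʳ ½) (ℚ.*-monoʳ-<-pos ½ 0<ε)

    +-diff : ∀ a b c d → (a ℚ.+ b) ℚ.- (c ℚ.+ d) ≡ (a ℚ.- c) ℚ.+ (b ℚ.- d)
    +-diff = solve 4 (λ a b c d → (a :+ b) :- (c :+ d) := (a :- c) :+ (b :- d)) refl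

    neg-diff : ∀ a b → (ℚ.- a) ℚ.- (ℚ.- b) ≡ ℚ.- (a ℚ.- b)
    neg-diff = solve 2 (λ a b → (:- a) :- (:- b) := :- (a :- b)) refl

    *-diff : ∀ k a b → k ℚ.* a ℚ.- k ℚ.* b ≡ k ℚ.* (a ℚ.- b)
    *-diff = solve 3 (λ k a b → k :* a :- k :* b := k :* (a :- b)) refl

  infix 8 -_
  infixl 7 _·_
  infixl 6 _+_ _-_

  fromℚ : ℚ → ℝ
  fromℚ q .seq _ = q
  fromℚ q .cauchy ε 0<ε = 0 , λ _ _ _ _ →
    subst (ℚ._< ε) (sym (cong ℚ.∣_∣ (ℚ.+-inverseʳ q))) 0<ε

  _+_ : ℝ → ℝ → ℝ
  (x + y) .seq n = seq x n ℚ.+ seq y n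
  (x + y) .cauchy ε 0<ε
    with cauchy x (½ ℚ.* ε) (half-pos 0<ε) | cauchy y (½ ℚ.* ε) (half-pos 0<ε)
  ... | M , x-close | N , y-close = M ℕ.⊔ N , λ m n M⊔N≤m M⊔N≤n →
    let x-near = x-close m n (ℕ.m⊔n≤o⇒m≤o M N M⊔N≤m) (ℕ.m⊔n≤o⇒m≤o M N M⊔N≤n)
        y-near = y-close m n (ℕ.m⊔n≤o⇒n≤o M N M⊔N≤m) (ℕ.m⊔n≤o⇒n≤o M N M⊔N≤n)
    in begin-strict
      ℚ.∣ (seq x m ℚ.+ seq y m) ℚ.- (seq x n ℚ.+ seq y n) ∣
        ≡⟨ cong ℚ.∣_∣ (+-diff (seq x m) (seq y m) (seq x n) (seq y n)) ⟩
      ℚ.∣ (seq x m ℚ.- seq x n) ℚ.+ (seq y m ℚ.- seq y n) ∣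
        ≤⟨ ℚ.∣p+q∣≤∣p∣+∣q∣ (seq x m ℚ.- seq x n) (seq y m ℚ.- seq y n) ⟩
      ℚ.∣ seq x m ℚ.- seq x n ∣ ℚ.+ ℚ.∣ seq y m ℚ.- seq y n ∣
        <⟨ ℚ.+-mono-< x-near y-near ⟩
      ½ ℚ.* ε ℚ.+ ½ ℚ.* ε
        ≡⟨ half+half ε ⟩
      ε ∎
    where open ℚ.≤-Reasoning

  -_ : ℝ → ℝ
  (- x) .seq n = ℚ.- seq x n
  (- x) .cauchy ε 0<ε with cauchy x ε 0<ε
  ... | N , close = N , λ m n N≤m N≤n →
    subst (ℚ._< ε)
      (sym (trans (cong ℚ.∣_∣ (neg-diff (seq x m) (seq x n)))
                  (ℚ.∣-p∣≡∣p∣ (seq x m ℚ.- seq x n))))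
      (close m n N≤m N≤n)

  _-_ : ℝ → ℝ → ℝ
  x - y = x + (- y)

  private
    shrink : ∀ a b .{{_ : ℚ.Positive b}} → a ℚ.≤ b → ∀ ε → 0ℚ ℚ.< ε →
             ∃ λ δ → 0ℚ ℚ.< δ × ∀ d → 0ℚ ℚ.≤ d → d ℚ.< δ → a ℚ.* d ℚ.< ε
    shrink a b a≤b ε 0<ε = b⁻¹ ℚ.* ε , 0<δ , λ d 0≤d d<δ → begin-strict
      a ℚ.* d            ≤⟨ ℚ.*-monoʳ-≤-nonNeg d {{ℚ.nonNegative 0≤d}} a≤b ⟩
      b ℚ.* d            <⟨ ℚ.*-monoʳ-<-pos b d<δ ⟩
      b ℚ.* (b⁻¹ ℚ.* ε)  ≡⟨ ℚ.*-assoc b b⁻¹ ε ⟨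
      b ℚ.* b⁻¹ ℚ.* ε    ≡⟨ cong (ℚ._* ε) (ℚ.*-inverseʳ b {{ℚ.pos⇒nonZero b}}) ⟩
      1ℚ ℚ.* ε           ≡⟨ ℚ.*-identityˡ ε ⟩
      ε                  ∎
      where
      open ℚ.≤-Reasoning
      b⁻¹ : ℚ
      b⁻¹ = ℚ.1/_ b {{ℚ.pos⇒nonZero b}}
      0<δ : 0ℚ ℚ.< b⁻¹ ℚ.* ε
      0<δ = subst (ℚ._< b⁻¹ ℚ.* ε) (ℚ.*-zeroʳ b⁻¹)
        (ℚ.*-monoʳ-<-pos b⁻¹ {{ℚ.1/pos⇒pos b}} 0<ε)

    1+∣_∣-positive : ∀ k → ℚ.Positive (1ℚ ℚ.+ ℚ.∣ k ∣)
    1+∣ k ∣-positive = ℚ.positive (ℚ.+-mono-<-≤ (ℚ.positive⁻¹ 1ℚ) (ℚ.0≤∣p∣ k))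

    ∣_∣≤1+ : ∀ k → ℚ.∣ k ∣ ℚ.≤ 1ℚ ℚ.+ ℚ.∣ k ∣
    ∣ k ∣≤1+ = subst (ℚ._≤ 1ℚ ℚ.+ ℚ.∣ k ∣) (ℚ.+-identityˡ ℚ.∣ k ∣)
      (ℚ.+-monoˡ-≤ ℚ.∣ k ∣ (ℚ.<⇒≤ (ℚ.positive⁻¹ 1ℚ)))

  _·_ : ℚ → ℝ → ℝ
  (k · x) .seq n = k ℚ.* seq x n
  (k · x) .cauchy ε 0<ε =
    let δ , 0<δ , small =
          shrink ℚ.∣ k ∣ (1ℚ ℚ.+ ℚ.∣ k ∣) {{1+∣ k ∣-positive}} ∣ k ∣≤1+ ε 0<ε
        N , close = cauchy x δ 0<δ
    in N , λ m n N≤m N≤n →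
      subst (ℚ._< ε)
        (sym (trans (cong ℚ.∣_∣ (*-diff k (seq x m) (seq x n)))
                    (ℚ.∣p*q∣≡∣p∣*∣q∣ k (seq x m ℚ.- seq x n))))
        (small ℚ.∣ seq x m ℚ.- seq x n ∣ (ℚ.0≤∣p∣ (seq x m ℚ.- seq x n))
          (close m n N≤m N≤n))

  infix 4 _<_ _≤_

  _<_ : ℝ → ℝ → Set
  x < y = ∃ λ ε → 0ℚ ℚ.< ε × ∃ λ N → ∀ n → N ℕ.≤ n → seq x n ℚ.+ ε ℚ.≤ seq y n

  _≤_ : ℝ → ℝ → Set
  x ≤ y = ∀ ε → 0ℚ ℚ.< ε → ∃ λ N → ∀ n → N ℕ.≤ n → seq x n ℚ.≤ seq y n ℚ.+ ε

  <-fromℚ-upward : ∀ x p q → x < fromℚ p → p ℚ.< q → x < fromℚ q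
  <-fromℚ-upward x p q (ε , 0<ε , N , below) p<q =
    ε , 0<ε , N , λ n N≤n → ℚ.≤-trans (below n N≤n) (ℚ.<⇒≤ p<q)

  <-fromℚ-open : ∀ x q → x < fromℚ q → ∃ λ p → p ℚ.< q × x < fromℚ p
  <-fromℚ-open x q (ε , 0<ε , N , below) =
    q ℚ.- ½ ℚ.* ε ,
    subst (q ℚ.- ½ ℚ.* ε ℚ.<_) (ℚ.+-identityʳ q)
      (ℚ.+-monoʳ-< q (ℚ.neg-antimono-< (half-pos 0<ε))) ,
    ½ ℚ.* ε , half-pos 0<ε , N , λ n N≤n →
      subst (ℚ._≤ q ℚ.- ½ ℚ.* ε) (regroup (seq x n) ε)
        (ℚ.+-monoˡ-≤ (ℚ.- (½ ℚ.* ε)) (below n N≤n))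
    where
    cancel : ∀ a h → (a ℚ.+ (h ℚ.+ h)) ℚ.- h ≡ a ℚ.+ h
    cancel = solve 2 (λ a h → (a :+ (h :+ h)) :- h := a :+ h) refl
    regroup : ∀ a e → (a ℚ.+ e) ℚ.- ½ ℚ.* e ≡ a ℚ.+ ½ ℚ.* e
    regroup a e = trans
      (cong (λ z → (a ℚ.+ z) ℚ.- ½ ℚ.* e) (sym (half+half e)))
      (cancel a (½ ℚ.* e))

------------------------------------------------------------------------
-- Constructively, the infimum of a set of reals need not be given by a
-- Cauchy sequence.  It always exists as an upper real: a real (or ±∞)
-- given by the set of rationals strictly above it.

record UpperReal : Set₁ where
  field
    Above  : ℚ → Set
    upward : ∀ p q → Above p → p ℚ.< q → Above q
    open′  : ∀ q → Above q → ∃ λ p → p ℚ.< q × Above p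

open UpperReal public

infix 4 _≤ᵘ_

_≤ᵘ_ : UpperReal → UpperReal → Set
u ≤ᵘ v = ∀ y → Above v y → Above u y

upper : ℝ → UpperReal
upper x .Above y = x < fromℚ y
upper x .upward  = <-fromℚ-upward x
upper x .open′   = <-fromℚ-open x

inf : Pred ℝ 0ℓ → UpperReal
inf S .Above y = ∃ λ w → S w × w < fromℚ y
inf S .upward p q (w , w∈S , w<p) p<q = w , w∈S , <-fromℚ-upward w p q w<p p<q
inf S .open′ q (w , w∈S , w<q) =
  let p , p<q , w<p = <-fromℚ-open w q w<q in p , p<q , w , w∈S , w<p

inf-lower : ∀ (S : Pred ℝ 0ℓ) w → S w → inf S ≤ᵘ upper w
inf-lower S w w∈S y w<y = w , w∈S , w<y

inf-greatest : ∀ (S : Pred ℝ 0ℓ) u → (∀ w → S w → u ≤ᵘ upper w) → u ≤ᵘ inf S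
inf-greatest S u bound y (w , w∈S , w<y) = bound w w∈S y w<y

------------------------------------------------------------------------

pos neg : ℤ → ℕ
pos (+ k)      = k
pos ℤ.-[1+ k ] = 0
neg (+ k)      = 0
neg ℤ.-[1+ k ] = suc k

-- a ≤ C n ^ (p / d), for n ≥ 1 and d > 0: both sides are raised to the
-- power d, and a negative p is moved to the left-hand side.
AtMostPowerℚ : (a C n : ℕ) → ℚ → Set
AtMostPowerℚ a C n y =
  a ℕ.^ (↧ₙ y) ℕ.* n ℕ.^ neg (↥ y) ℕ.≤ C ℕ.^ (↧ₙ y) ℕ.* n ℕ.^ pos (↥ y)

-- a ≤ C n ^ x, for n ≥ 1: here n ^ x is the infimum of n ^ y over the
-- rationals y > x.
AtMostPower : (a C n : ℕ) → ℝ → Set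
AtMostPower a C n x = ∀ y → x < fromℚ y → AtMostPowerℚ a C n y

_=O[n^_] : (ℕ → ℕ) → ℝ → Set
f =O[n^ x ] = ∃ λ C → ∃ λ N → ∀ n → 1 ℕ.≤ n → N ℕ.≤ n → AtMostPower (f n) C n x

------------------------------------------------------------------------

∑ : {A : Set} → List A → (A → ℤ) → ℤ
∑ xs f = foldr ℤ._+_ 0ℤ (map f xs)

syntax ∑ xs (λ x → e) = ∑[ x ∈ xs ] e
infix 5 ∑

------------------------------------------------------------------------

infix 8 _choose_

_choose_ : ℕ → ℕ → Set
n choose q = ∃ λ (A : Subset n) → ∣ A ∣ ≡ q

with-zero : ∀ {n q} → n choose q → suc n choose suc q
with-zero (A , ∣A∣≡q) = inside ∷ A , cong suc ∣A∣≡q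

without-zero : ∀ {n q} → n choose q → suc n choose q
without-zero (A , ∣A∣≡q) = outside ∷ A , ∣A∣≡q

all-choose : ∀ n q → List (n choose q)
all-choose zero    zero    = ([] , refl) ∷ []
all-choose zero    (suc q) = []
all-choose (suc n) zero    = map without-zero (all-choose n zero)
all-choose (suc n) (suc q) =
  map with-zero (all-choose n q) ++ map without-zero (all-choose n (suc q))

all-choose-complete : ∀ n q (A : n choose q) → A ∈ all-choose n q
all-choose-complete zero    zero    ([] , refl) = here refl
all-choose-complete (suc n) zero    (outside ∷ A , eq) =
  ∈-map⁺ without-zero (all-choose-complete n zero (A , eq))
all-choose-complete (suc n) (suc q) (inside ∷ A , refl) =
  ∈-++⁺ˡ (∈-map⁺ with-zero (all-choose-complete n q (A , refl)))
all-choose-complete (suc n) (suc q) (outside ∷ A , eq) =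
  ∈-++⁺ʳ _ (∈-map⁺ without-zero (all-choose-complete n (suc q) (A , eq)))

private
  choose-≡ : ∀ {n q} {A B : n choose q} → proj₁ A ≡ proj₁ B → A ≡ B
  choose-≡ {A = A , p} {.A , p′} refl = cong (A ,_) (ℕ.≡-irrelevant p p′)

all-choose-unique : ∀ n q → Unique (all-choose n q)
all-choose-unique zero    zero    = [] ∷ []
all-choose-unique zero    (suc q) = []
all-choose-unique (suc n) zero    =
  Unique.map⁺ without-injective (all-choose-unique n zero)
  where
  without-injective : ∀ {A B : n choose zero} → without-zero A ≡ without-zero B → A ≡ B
  without-injective refl = refl
all-choose-unique (suc n) (suc q) = Unique.++⁺
  (Unique.map⁺ with-injective (all-choose-unique n q))
  (Unique.map⁺ without-injective (all-choose-unique n (suc q)))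
  λ (∈ₗ , ∈ᵣ) → apart (∈-map⁻ with-zero ∈ₗ) (∈-map⁻ without-zero ∈ᵣ)
  where
  with-injective : ∀ {A B : n choose q} → with-zero A ≡ with-zero B → A ≡ B
  with-injective eq = choose-≡ (∷-injectiveʳ (cong proj₁ eq))
  without-injective : ∀ {A B : n choose suc q} → without-zero A ≡ without-zero B → A ≡ B
  without-injective refl = refl
  apart : ∀ {X} → (∃ λ A → A ∈ all-choose n q × X ≡ with-zero A) →
          (∃ λ B → B ∈ all-choose n (suc q) × X ≡ without-zero B) → ⊥
  apart (_ , _ , refl) (_ , _ , ())

------------------------------------------------------------------------

PairwiseDisjoint : ∀ {n q} → Pred (n choose q × n choose q × n choose q) 0ℓ
PairwiseDisjoint ((A , _) , (B , _) , (C , _)) =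
  Empty (A ∩ B) × Empty (A ∩ C) × Empty (B ∩ C)

pairwiseDisjoint? : ∀ {n q} → Decidable (PairwiseDisjoint {n} {q})
pairwiseDisjoint? ((A , _) , (B , _) , (C , _)) =
  ¬? (nonempty? (A ∩ B)) ×-dec ¬? (nonempty? (A ∩ C)) ×-dec ¬? (nonempty? (B ∩ C))

disjointTriples : ∀ n q → List (n choose q × n choose q × n choose q)
disjointTriples n q = filter pairwiseDisjoint?
  (cartesianProduct sets (cartesianProduct sets sets))
  where sets = all-choose n q

Δ : ∀ {n q} → (f g h : n choose q → ℤ) → ℤ
Δ {n} {q} f g h = ∑[ t ∈ disjointTriples n q ] term t
  where
  term : n choose q × n choose q × n choose q → ℤ
  term (A , B , C) = f A ℤ.* g B ℤ.* h C

record TrilinearAlgorithm (n q r : ℕ) : Set where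
  field
    coeff   : Fin r → ℤ
    α β γ   : Fin r → n choose q → ℤ
    correct : ∀ (f g h : n choose q → ℤ) →
      Δ f g h ≡
        (∑[ s ∈ allFin r ]
          coeff s
            ℤ.* (∑[ A ∈ all-choose n q ] α s A ℤ.* f A)
            ℤ.* (∑[ B ∈ all-choose n q ] β s B ℤ.* g B)
            ℤ.* (∑[ C ∈ all-choose n q ] γ s C ℤ.* h C))

------------------------------------------------------------------------

data Op : Set where
  add sub mul div : Op

-- The result of a division is the exact quotient; there is none if the
-- divisor is zero or does not divide the dividend.
Result : Op → ℤ → ℤ → ℤ → Set
Result add a b v = v ≡ a ℤ.+ b
Result sub a b v = v ≡ a ℤ.- b
Result mul a b v = v ≡ a ℤ.* b
Result div a b v = b ≢ 0ℤ × a ≡ v ℤ.* b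

-- I indexes the inputs; m is the number of intermediate results so far.
data Operand (I : Set) (m : ℕ) : Set where
  const  : ℤ → Operand I m
  input  : I → Operand I m
  result : Fin m → Operand I m

data Program (I O : Set) (m : ℕ) : Set where
  return : (O → Operand I m) → Program I O m
  step   : Op → Operand I m → Operand I m → Program I O (suc m) → Program I O m

module _ {I O : Set} where

  operations : ∀ {m} → Program I O m → ℕ
  operations (return _)     = 0
  operations (step _ _ _ P) = suc (operations P)

  value : ∀ {m} → (I → ℤ) → Vec.Vec ℤ m → Operand I m → ℤ
  value x ρ (const k)  = k
  value x ρ (input i)  = x i
  value x ρ (result j) = Vec.lookup ρ j

  -- Every step has a result, and the outputs are given by y.
  Runs : ∀ {m} → Program I O m → (I → ℤ) → Vec.Vec ℤ m → (O → ℤ) → Set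
  Runs (return out)    x ρ y = ∀ o → value x ρ (out o) ≡ y o
  Runs (step op a b P) x ρ y =
    ∃ λ v → Result op (value x ρ a) (value x ρ b) v × Runs P x (v ∷ ρ) y

------------------------------------------------------------------------

Index : ℕ → Set
Index N = Fin N × Fin N

Matrix : ℕ → Set
Matrix N = Index N → ℤ

_⊗_ : ∀ {N} → Matrix N → Matrix N → Matrix N
_⊗_ {N} X Y (i , j) = ∑[ k ∈ allFin N ] X (i , k) ℤ.* Y (k , j)

entries : ∀ {N} → Matrix N → Matrix N → Index N ⊎ Index N → ℤ
entries X Y (inj₁ ij) = X ij
entries X Y (inj₂ ij) = Y ij

MultipliesMatrices : ∀ N → Program (Index N ⊎ Index N) (Index N) 0 → Set
MultipliesMatrices N P = ∀ (X Y : Matrix N) → Runs P (entries X Y) [] (X ⊗ Y)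

MatMulExponent : Pred ℝ 0ℓ
MatMulExponent w = ∃ λ (T : ℕ → ℕ) → T =O[n^ w ] ×
  (∀ N → ∃ λ P → MultipliesMatrices N P × operations P ≡ T N)

ω : UpperReal
ω = inf MatMulExponent

-- In each of 3p groups of elements, consisting of m letters and a dummy letter *,
-- two of the sets A, B, C pick one letter.  Disjointness tests that the letters
-- differ, and [a = c] = [* ≠ c] - [a ≠ c] turns this into a test of equality by a
-- linear change of the inputs.  So for q = 2p and n = 3p(m + 1) an algorithm for Δ
-- of rank r yields one of rank r for matrices of size m^p.  Applying it once to
-- matrices of size m^(3p), with blocks of size m^(2p) multiplied naively, costs
-- O(r m^(6p)) operations.  When r = O(n^(6p(1/2 - τ) + c)) this is
-- O(m^(9p - 6pτ + c)) = O((m^(3p))^(3 - 2τ + c/(3p))), and c/(3p) ≤ τ for large p.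
-- The loss from 6τ to 2τ in the exponent is affordable, so no recursion is needed.

module Submission where

open import Defs
open import Data.Nat.Base as ℕ using (ℕ; zero; suc; NonZero)
import Data.Nat.Coprimality as Coprime
import Data.Nat.Properties as ℕ
open import Data.Nat.Tactic.RingSolver using () renaming (solve-∀ to solve-∀ᴺ)
open import Data.Integer.Base as ℤ using (ℤ; +_; -[1+_]; 0ℤ; 1ℤ)
import Data.Integer.Properties as ℤ
open import Data.Integer.Tactic.RingSolver using (solve-∀)
open import Data.Rational.Base as ℚ
  using (ℚ; mkℚ; 0ℚ; 1ℚ; ½; _/_; ↥_; ↧_; ↧ₙ_; toℚᵘ; *≤*)
import Data.Rational.Properties as ℚ
open import Data.Rational.Solver using (module +-*-Solver)
open import Data.Rational.Unnormalised.Base as ℚᵘ using (mkℚᵘ; *≡*)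
import Data.Rational.Unnormalised.Properties as ℚᵘ
import Data.Bool.Properties as Bool
open import Data.Fin.Base as Fin using (Fin; zero; suc; remQuot; combine; inject≤)
import Data.Fin.Properties as Fin
open import Data.Fin.Subset using (Subset; inside; outside; ∣_∣; _∩_; Empty; ⁅_⁆; ⊥)
open import Data.Fin.Subset.Properties using (∣⊥∣≡0; ∣⁅x⁆∣≡1; nonempty?)
open import Data.List.Base as List
  using (List; []; _∷_; map; allFin; cartesianProduct; length)
open import Data.List.Membership.Propositional using (_∈_)
open import Data.List.Membership.Propositional.Properties
  using (∈-allFin; ∈-cartesianProduct⁺; ∈-filter⁺; ∈-filter⁻)
open import Data.List.Properties using (length-tabulate; length-++; length-map)
import Data.List.Relation.Unary.All as All
open import Data.List.Relation.Unary.Any using (here; there)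
open import Data.List.Relation.Unary.Unique.Propositional using (Unique; []; _∷_)
import Data.List.Relation.Unary.Unique.Propositional.Properties as Unique
open import Data.Product.Base using (∃; _×_; _,_; proj₁; proj₂; uncurry)
import Data.Product.Properties as Product
open import Data.Sum.Base using (_⊎_; inj₁; inj₂)
open import Data.Vec.Base as Vec using (Vec; []; _∷_; _++_)
import Data.Vec.Properties as Vec
open import Function.Base using (_∘_; id)
open import Relation.Binary.Definitions using (DecidableEquality)
open import Relation.Binary.PropositionalEquality
  using (_≡_; _≢_; refl; sym; trans; cong; cong₂; subst; subst₂; module ≡-Reasoning)
open import Relation.Nullary using (Dec; yes; no; ¬_; contradiction)
open import Relation.Nullary.Decidable using (¬?)

-- A product of p differences e_* - e_a expands into 2^p terms, but it is substituted into the
-- linear forms of the algorithm: it changes their coefficients and leaves the number r of products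
-- alone. To give exactly [a = c], it is applied to one of the two sets that share a group, while
-- the other set never picks the dummy letter. Programs may use arbitrary integer constants, so the
-- coefficients cost nothing although they depend on m. Hence m can grow with the size of the
-- matrices while p and q stay fixed. The numbers τ and c are Cauchy reals and ω is an upper real,
-- so the exponent 3 - τ is replaced by a rational w = a/b with 3 - τ ≤ w < 3 that lies below a
-- given y. With p a multiple of b all exponents of m and n become integers, and the cost estimates
-- take place in the natural numbers after raising to the power b. If w < 2, the exponent 3p(w - 2)
-- of the rank is negative; the rank would drop below 1 for large n, which a nonzero tensor forbids.

private variable
  A B I O U : Set

-- Finite sums of integers

∑-cong-∈ : ∀ (xs : List A) {f g : A → ℤ} → (∀ {x} → x ∈ xs → f x ≡ g x) → ∑ xs f ≡ ∑ xs g
∑-cong-∈ []       eq = refl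
∑-cong-∈ (x ∷ xs) eq = cong₂ ℤ._+_ (eq (here refl)) (∑-cong-∈ xs (eq ∘ there))

∑-cong : ∀ (xs : List A) {f g : A → ℤ} → (∀ x → f x ≡ g x) → ∑ xs f ≡ ∑ xs g
∑-cong xs eq = ∑-cong-∈ xs (λ {x} _ → eq x)

∑-zero : ∀ (xs : List A) → (∑[ _ ∈ xs ] 0ℤ) ≡ 0ℤ
∑-zero []       = refl
∑-zero (_ ∷ xs) = trans (ℤ.+-identityˡ _) (∑-zero xs)

∑-++ : ∀ (xs ys : List A) f → ∑ (xs List.++ ys) f ≡ ∑ xs f ℤ.+ ∑ ys f
∑-++ []       ys f = sym (ℤ.+-identityˡ _)
∑-++ (x ∷ xs) ys f =
  trans (cong (ℤ._+_ (f x)) (∑-++ xs ys f)) (sym (ℤ.+-assoc (f x) _ _))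

∑-map : ∀ (h : A → B) xs f → ∑ (map h xs) f ≡ ∑ xs (f ∘ h)
∑-map h []       f = refl
∑-map h (x ∷ xs) f = cong (ℤ._+_ (f (h x))) (∑-map h xs f)

∑-cartesianProduct : ∀ (xs : List A) (ys : List B) f →
  ∑ (cartesianProduct xs ys) f ≡ (∑[ x ∈ xs ] ∑[ y ∈ ys ] f (x , y))
∑-cartesianProduct []       ys f = refl
∑-cartesianProduct (x ∷ xs) ys f =
  trans (∑-++ (map (x ,_) ys) (cartesianProduct xs ys) f)
    (cong₂ ℤ._+_ (∑-map (x ,_) ys f) (∑-cartesianProduct xs ys f))

∑-+ : ∀ (xs : List A) f g → (∑[ x ∈ xs ] f x ℤ.+ g x) ≡ ∑ xs f ℤ.+ ∑ xs g
∑-+ []       f g = refl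
∑-+ (x ∷ xs) f g =
  trans (cong (ℤ._+_ (f x ℤ.+ g x)) (∑-+ xs f g)) (interchange (f x) (g x) _ _)
  where
  interchange : ∀ a b c d → a ℤ.+ b ℤ.+ (c ℤ.+ d) ≡ a ℤ.+ c ℤ.+ (b ℤ.+ d)
  interchange = solve-∀

∑-neg : ∀ (xs : List A) f → (∑[ x ∈ xs ] ℤ.- f x) ≡ ℤ.- ∑ xs f
∑-neg []       f = refl
∑-neg (x ∷ xs) f =
  trans (cong (ℤ._+_ (ℤ.- f x)) (∑-neg xs f)) (sym (ℤ.neg-distrib-+ (f x) _))

∑-*ʳ : ∀ (xs : List A) f c → ∑ xs f ℤ.* c ≡ (∑[ x ∈ xs ] f x ℤ.* c)
∑-*ʳ []       f c = refl
∑-*ʳ (x ∷ xs) f c =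
  trans (ℤ.*-distribʳ-+ c (f x) _) (cong (ℤ._+_ (f x ℤ.* c)) (∑-*ʳ xs f c))

∑-*ˡ : ∀ (xs : List A) f c → c ℤ.* ∑ xs f ≡ (∑[ x ∈ xs ] c ℤ.* f x)
∑-*ˡ xs f c = trans (ℤ.*-comm c _)
  (trans (∑-*ʳ xs f c) (∑-cong xs λ x → ℤ.*-comm (f x) c))

∑-swap : ∀ (xs : List A) (ys : List B) (f : A → B → ℤ) →
  (∑[ x ∈ xs ] ∑[ y ∈ ys ] f x y) ≡ (∑[ y ∈ ys ] ∑[ x ∈ xs ] f x y)
∑-swap []       ys f = sym (∑-zero ys)
∑-swap (x ∷ xs) ys f =
  trans (cong (ℤ._+_ (∑ ys (f x))) (∑-swap xs ys f)) (sym (∑-+ ys (f x) _))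

∑-*-∑ : ∀ (xs : List A) (ys : List B) f g →
  ∑ xs f ℤ.* ∑ ys g ≡ (∑[ x ∈ xs ] ∑[ y ∈ ys ] f x ℤ.* g y)
∑-*-∑ xs ys f g = trans (∑-*ʳ xs f _) (∑-cong xs λ x → ∑-*ˡ ys g (f x))

∑-single : ∀ {xs : List A} {a} f → Unique xs → a ∈ xs →
  (∀ x → x ≢ a → f x ≡ 0ℤ) → ∑ xs f ≡ f a
∑-single {xs = x ∷ xs} f (x∉xs ∷ _) (here refl) vanish =
  trans (cong (ℤ._+_ (f x))
    (trans (∑-cong-∈ xs λ y∈xs → vanish _ (All.lookup x∉xs y∈xs ∘ sym)) (∑-zero xs)))
    (ℤ.+-identityʳ (f x))
∑-single {xs = x ∷ xs} f (x∉xs ∷ xs!) (there a∈xs) vanish =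
  trans (cong₂ ℤ._+_ (vanish x (All.lookup x∉xs a∈xs)) (∑-single f xs! a∈xs vanish))
    (ℤ.+-identityˡ _)

module _ (_≟_ : DecidableEquality A) where

  δ : A → A → ℤ
  δ a x with a ≟ x
  ... | yes _ = 1ℤ
  ... | no  _ = 0ℤ

  δ-≡ : ∀ {a x} → a ≡ x → δ a x ≡ 1ℤ
  δ-≡ {a} {x} a≡x with a ≟ x
  ... | yes _   = refl
  ... | no  a≢x = contradiction a≡x a≢x

  δ-≢ : ∀ {a x} → a ≢ x → δ a x ≡ 0ℤ
  δ-≢ {a} {x} a≢x with a ≟ x
  ... | yes a≡x = contradiction a≡x a≢x
  ... | no  _   = refl

  ∑-δ : ∀ {xs : List A} {a} (f : A → ℤ) → Unique xs → a ∈ xs → (∑[ x ∈ xs ] f x ℤ.* δ a x) ≡ f a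
  ∑-δ {xs} {a} f xs! a∈xs = trans
    (∑-single (λ x → f x ℤ.* δ a x) xs! a∈xs λ x x≢a →
      trans (cong (ℤ._*_ (f x)) (δ-≢ (x≢a ∘ sym))) (ℤ.*-zeroʳ (f x)))
    (trans (cong (ℤ._*_ (f a)) (δ-≡ refl)) (ℤ.*-identityʳ (f a)))

-- Each g (e x) is a sum of point masses over `ys`; after exchanging the sums, the fibre over y
-- holds one x by injectivity, or none, and then g y is zero as well. This lets a sum over matrix
-- indices run over all positions of a larger zero-padded matrix.
∑-embed : ∀ (_≟_ : DecidableEquality B) {xs : List A} {ys : List B} (e : A → B) (g : B → ℤ) →
  Unique xs → Unique ys → (∀ x → x ∈ xs) → (∀ y → y ∈ ys) →
  (∀ {x x′} → e x ≡ e x′ → x ≡ x′) → (∀ y → Dec (∃ λ x → e x ≡ y)) →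
  (∀ y → ¬ (∃ λ x → e x ≡ y) → g y ≡ 0ℤ) →
  ∑ ys g ≡ ∑ xs (g ∘ e)
∑-embed _≟_ {xs} {ys} e g xs! ys! ∈xs ∈ys e-injective image? vanish = sym (begin
  (∑[ x ∈ xs ] g (e x))
    ≡⟨ ∑-cong xs (λ x → ∑-δ _≟_ g ys! (∈ys (e x))) ⟨
  (∑[ x ∈ xs ] ∑[ y ∈ ys ] g y ℤ.* δ _≟_ (e x) y)
    ≡⟨ ∑-swap xs ys _ ⟩
  (∑[ y ∈ ys ] ∑[ x ∈ xs ] g y ℤ.* δ _≟_ (e x) y)
    ≡⟨ ∑-cong ys fibre ⟩
  ∑ ys g ∎)
  where
  open ≡-Reasoning
  fibre : ∀ y → (∑[ x ∈ xs ] g y ℤ.* δ _≟_ (e x) y) ≡ g y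
  fibre y with image? y
  ... | no  y∉e = trans
    (∑-cong xs λ x → cong (ℤ._* δ _≟_ (e x) y) (vanish y y∉e))
    (trans (∑-zero xs) (sym (vanish y y∉e)))
  ... | yes (x₀ , refl) = trans
    (∑-single _ xs! (∈xs x₀) λ x x≢x₀ →
      trans (cong (ℤ._*_ (g y)) (δ-≢ _≟_ (x≢x₀ ∘ e-injective))) (ℤ.*-zeroʳ (g y)))
    (trans (cong (ℤ._*_ (g y)) (δ-≡ _≟_ refl)) (ℤ.*-identityʳ (g y)))

-- Disjointness as an integer, and the tensor of Δ

disjoint : ∀ {n} → Subset n → Subset n → ℤ
disjoint []            []            = 1ℤ
disjoint (outside ∷ A) (_       ∷ B) = disjoint A B
disjoint (inside  ∷ A) (outside ∷ B) = disjoint A B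
disjoint (inside  ∷ A) (inside  ∷ B) = 0ℤ

Empty-tail : ∀ {n x} {A : Subset n} → Empty (x ∷ A) → Empty A
Empty-tail empty (i , i∈A) = empty (suc i , Vec.there i∈A)

Empty-outside : ∀ {n} {A : Subset n} → Empty A → Empty (outside ∷ A)
Empty-outside empty (suc i , Vec.there i∈A) = empty (i , i∈A)

disjoint-Empty : ∀ {n} (A B : Subset n) → Empty (A ∩ B) → disjoint A B ≡ 1ℤ
disjoint-Empty []            []            _     = refl
disjoint-Empty (outside ∷ A) (_       ∷ B) empty = disjoint-Empty A B (Empty-tail empty)
disjoint-Empty (inside  ∷ A) (outside ∷ B) empty = disjoint-Empty A B (Empty-tail empty)
disjoint-Empty (inside  ∷ A) (inside  ∷ B) empty = contradiction (zero , Vec.here) empty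

disjoint-¬Empty : ∀ {n} (A B : Subset n) → ¬ Empty (A ∩ B) → disjoint A B ≡ 0ℤ
disjoint-¬Empty []            []            meet = contradiction (λ { (() , _) }) meet
disjoint-¬Empty (outside ∷ A) (_       ∷ B) meet = disjoint-¬Empty A B (meet ∘ Empty-outside)
disjoint-¬Empty (inside  ∷ A) (outside ∷ B) meet = disjoint-¬Empty A B (meet ∘ Empty-outside)
disjoint-¬Empty (inside  ∷ A) (inside  ∷ B) meet = refl

-- The reason for integer values instead of a predicate: tests on separate parts of the universe
-- multiply, and their differences make sense.
disjoint-++ : ∀ {m n} (A B : Subset m) (A′ B′ : Subset n) →
  disjoint (A ++ A′) (B ++ B′) ≡ disjoint A B ℤ.* disjoint A′ B′
disjoint-++ []            []            A′ B′ = sym (ℤ.*-identityˡ _)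
disjoint-++ (outside ∷ A) (_       ∷ B) A′ B′ = disjoint-++ A B A′ B′
disjoint-++ (inside  ∷ A) (outside ∷ B) A′ B′ = disjoint-++ A B A′ B′
disjoint-++ (inside  ∷ A) (inside  ∷ B) A′ B′ = refl

disjoint-⊥ˡ : ∀ {n} (A : Subset n) → disjoint ⊥ A ≡ 1ℤ
disjoint-⊥ˡ []      = refl
disjoint-⊥ˡ (_ ∷ A) = disjoint-⊥ˡ A

disjoint-⊥ʳ : ∀ {n} (A : Subset n) → disjoint A ⊥ ≡ 1ℤ
disjoint-⊥ʳ []            = refl
disjoint-⊥ʳ (outside ∷ A) = disjoint-⊥ʳ A
disjoint-⊥ʳ (inside  ∷ A) = disjoint-⊥ʳ A

δ-cong : ∀ {A B : Set} (_≟ᴬ_ : DecidableEquality A) (_≟ᴮ_ : DecidableEquality B)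
  {a x : A} {b y : B} → (a ≡ x → b ≡ y) → (b ≡ y → a ≡ x) → δ _≟ᴬ_ a x ≡ δ _≟ᴮ_ b y
δ-cong _≟ᴬ_ _≟ᴮ_ {a} {x} to from with a ≟ᴬ x
... | yes a≡x = sym (δ-≡ _≟ᴮ_ (to a≡x))
... | no  a≢x = sym (δ-≢ _≟ᴮ_ (a≢x ∘ from))

disjoint-⁅⁆ : ∀ {n} (a b : Fin n) → disjoint ⁅ a ⁆ ⁅ b ⁆ ≡ 1ℤ ℤ.- δ Fin._≟_ b a
disjoint-⁅⁆ zero    zero    = refl
disjoint-⁅⁆ zero    (suc b) = disjoint-⊥ˡ ⁅ b ⁆
disjoint-⁅⁆ (suc a) zero    = disjoint-⊥ʳ ⁅ a ⁆
disjoint-⁅⁆ (suc a) (suc b) = trans (disjoint-⁅⁆ a b)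
  (cong (λ d → 1ℤ ℤ.- d) (δ-cong Fin._≟_ Fin._≟_ {b} {a} {suc b} {suc a} (cong suc) Fin.suc-injective))

choose-≟ : ∀ {n q} → DecidableEquality (n choose q)
choose-≟ (A , ∣A∣≡q) (B , ∣B∣≡q) with Vec.≡-dec Bool._≟_ A B
... | yes refl = yes (cong (A ,_) (ℕ.≡-irrelevant ∣A∣≡q ∣B∣≡q))
... | no  A≢B  = no (A≢B ∘ cong proj₁)

*-vanishes₁ : ∀ {x} y z → x ≡ 0ℤ → x ℤ.* y ℤ.* z ≡ 0ℤ
*-vanishes₁ y z refl = refl

*-vanishes₂ : ∀ x {y} z → y ≡ 0ℤ → x ℤ.* y ℤ.* z ≡ 0ℤ
*-vanishes₂ x z refl = cong (ℤ._* z) (ℤ.*-zeroʳ x)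

*-vanishes₃ : ∀ x y {z} → z ≡ 0ℤ → x ℤ.* y ℤ.* z ≡ 0ℤ
*-vanishes₃ x y refl = ℤ.*-zeroʳ (x ℤ.* y)

-- Indicator functions kill every triple but (A, B, C), and the filter keeps this one precisely when
-- all three tests yield 1.
Δ-δ : ∀ {n q} (A B C : n choose q) →
  Δ (δ choose-≟ A) (δ choose-≟ B) (δ choose-≟ C) ≡
  disjoint (proj₁ A) (proj₁ B) ℤ.* disjoint (proj₁ A) (proj₁ C) ℤ.* disjoint (proj₁ B) (proj₁ C)
Δ-δ {n} {q} T₁@(A , _) T₂@(B , _) T₃@(C , _) = evaluate
  where
  open ≡-Reasoning
  sets = all-choose n q
  ∈sets = all-choose-complete n q
  sets! = all-choose-unique n q

  Triple = n choose q × n choose q × n choose q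

  term : Triple → ℤ
  term (X , Y , Z) = δ choose-≟ T₁ X ℤ.* δ choose-≟ T₂ Y ℤ.* δ choose-≟ T₃ Z

  term-vanishes : ∀ t → t ≢ (T₁ , T₂ , T₃) → term t ≡ 0ℤ
  term-vanishes (X , Y , Z) t≢T with choose-≟ T₁ X | choose-≟ T₂ Y | choose-≟ T₃ Z
  ... | no T₁≢X  | _        | _        = refl
  ... | yes _    | no T₂≢Y  | _        = refl
  ... | yes _    | yes _    | no T₃≢Z  = refl
  ... | yes refl | yes refl | yes refl = contradiction refl t≢T

  evaluate : (∑[ t ∈ disjointTriples n q ] term t) ≡
    disjoint A B ℤ.* disjoint A C ℤ.* disjoint B C
  evaluate with pairwiseDisjoint? (T₁ , T₂ , T₃)
  ... | yes apart@(A∩B , A∩C , B∩C) = begin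
    (∑[ t ∈ disjointTriples n q ] term t)
      ≡⟨ ∑-single term
          (Unique.filter⁺ pairwiseDisjoint?
            (Unique.cartesianProduct⁺ sets! (Unique.cartesianProduct⁺ sets! sets!)))
          (∈-filter⁺ pairwiseDisjoint?
            (∈-cartesianProduct⁺ (∈sets T₁) (∈-cartesianProduct⁺ (∈sets T₂) (∈sets T₃))) apart)
          term-vanishes ⟩
    term (T₁ , T₂ , T₃)
      ≡⟨ cong₂ ℤ._*_ (cong₂ ℤ._*_ (δ-≡ choose-≟ {T₁} refl) (δ-≡ choose-≟ {T₂} refl))
          (δ-≡ choose-≟ {T₃} refl) ⟩
    1ℤ
      ≡⟨ cong₂ ℤ._*_ (cong₂ ℤ._*_ (disjoint-Empty A B A∩B) (disjoint-Empty A C A∩C))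
          (disjoint-Empty B C B∩C) ⟨
    disjoint A B ℤ.* disjoint A C ℤ.* disjoint B C ∎
  ... | no ¬apart = trans
    (∑-cong-∈ (disjointTriples n q) λ {t} t∈ → term-vanishes t λ { refl →
      ¬apart (proj₂ (∈-filter⁻ pairwiseDisjoint? {xs = cartesianProduct sets (cartesianProduct sets sets)} t∈)) })
    (trans (∑-zero (disjointTriples n q)) (sym product-vanishes))
    where
    product-vanishes : disjoint A B ℤ.* disjoint A C ℤ.* disjoint B C ≡ 0ℤ
    product-vanishes with ¬? (nonempty? (A ∩ B)) | ¬? (nonempty? (A ∩ C)) | ¬? (nonempty? (B ∩ C))
    ... | no meet | _       | _       = *-vanishes₁ _ _ (disjoint-¬Empty A B meet)
    ... | yes _   | no meet | _       = *-vanishes₂ (disjoint A B) _ (disjoint-¬Empty A C meet)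
    ... | yes _   | yes _   | no meet = *-vanishes₃ (disjoint A B) _ (disjoint-¬Empty B C meet)
    ... | yes a   | yes b   | yes c   = contradiction (a , b , c) ¬apart

module _ {n q r} (T : TrilinearAlgorithm n q r) where
  open TrilinearAlgorithm T
  open ≡-Reasoning

  -- Testing a trilinear identity on indicator functions reads off its coefficients, so an algorithm
  -- becomes a rank decomposition of the disjointness tensor.
  disjoint-tensor : ∀ (A B C : n choose q) →
    (∑[ s ∈ allFin r ] coeff s ℤ.* α s A ℤ.* β s B ℤ.* γ s C) ≡
    disjoint (proj₁ A) (proj₁ B) ℤ.* disjoint (proj₁ A) (proj₁ C) ℤ.* disjoint (proj₁ B) (proj₁ C)
  disjoint-tensor A B C = begin
    (∑[ s ∈ allFin r ] coeff s ℤ.* α s A ℤ.* β s B ℤ.* γ s C)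
      ≡⟨ ∑-cong (allFin r) (λ s → cong₂ ℤ._*_ (cong₂ ℤ._*_ (cong (ℤ._*_ (coeff s))
          (pick (α s) A)) (pick (β s) B)) (pick (γ s) C)) ⟨
    _ ≡⟨ correct (δ choose-≟ A) (δ choose-≟ B) (δ choose-≟ C) ⟨
    Δ (δ choose-≟ A) (δ choose-≟ B) (δ choose-≟ C)
      ≡⟨ Δ-δ A B C ⟩
    disjoint (proj₁ A) (proj₁ B) ℤ.* disjoint (proj₁ A) (proj₁ C) ℤ.* disjoint (proj₁ B) (proj₁ C) ∎
    where
    pick : ∀ (φ : n choose q → ℤ) A → (∑[ X ∈ all-choose n q ] φ X ℤ.* δ choose-≟ A X) ≡ φ A
    pick φ A = ∑-δ choose-≟ φ (all-choose-unique n q) (all-choose-complete n q A)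

-- From the disjointness tensor to the matrix multiplication tensor

-- Applied to φ, the formal combination  ⊗ₜ (e₀ - e₁₊ₐₜ)  of the words over {0,…,m}.
extend : ∀ {m p} → (Vec (Fin (suc m)) p → ℤ) → Vec (Fin m) p → ℤ
extend φ []       = φ []
extend φ (a ∷ as) = extend (φ ∘ (zero ∷_)) as ℤ.- extend (φ ∘ (suc a ∷_)) as

extend-cong : ∀ {m p} {φ ψ : Vec (Fin (suc m)) p → ℤ} → (∀ v → φ v ≡ ψ v) → ∀ a → extend φ a ≡ extend ψ a
extend-cong eq []       = eq []
extend-cong eq (a ∷ as) = cong₂ ℤ._-_
  (extend-cong (λ v → eq (zero ∷ v)) as) (extend-cong (λ v → eq (suc a ∷ v)) as)

*-distribʳ-− : ∀ x y z → (x ℤ.- y) ℤ.* z ≡ x ℤ.* z ℤ.- y ℤ.* z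
*-distribʳ-− = solve-∀

extend-*ʳ : ∀ {m p} (φ : Vec (Fin (suc m)) p → ℤ) c a → extend φ a ℤ.* c ≡ extend (λ v → φ v ℤ.* c) a
extend-*ʳ φ c []       = refl
extend-*ʳ φ c (a ∷ as) = trans (*-distribʳ-− (extend (φ ∘ (zero ∷_)) as) _ c)
  (cong₂ ℤ._-_ (extend-*ʳ (φ ∘ (zero ∷_)) c as) (extend-*ʳ (φ ∘ (suc a ∷_)) c as))

-- Linearity of `extend`: substituting it into one factor of every product is the same as
-- substituting it into the whole sum. This is why the change of inputs keeps the rank.
∑-extend : ∀ {m p} (xs : List A) (φ : A → Vec (Fin (suc m)) p → ℤ) (c : A → ℤ) a →
  (∑[ x ∈ xs ] extend (φ x) a ℤ.* c x) ≡ extend (λ v → ∑[ x ∈ xs ] φ x v ℤ.* c x) a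
∑-extend xs φ c []       = refl
∑-extend xs φ c (a ∷ as) = begin
  (∑[ x ∈ xs ] (extend (φ₀ x) as ℤ.- extend (φ₁ x) as) ℤ.* c x)
    ≡⟨ ∑-cong xs (λ x → *-distribʳ-− (extend (φ₀ x) as) _ (c x)) ⟩
  (∑[ x ∈ xs ] extend (φ₀ x) as ℤ.* c x ℤ.- extend (φ₁ x) as ℤ.* c x)
    ≡⟨ ∑-+ xs _ _ ⟩
  (∑[ x ∈ xs ] extend (φ₀ x) as ℤ.* c x) ℤ.+ (∑[ x ∈ xs ] ℤ.- (extend (φ₁ x) as ℤ.* c x))
    ≡⟨ cong (ℤ._+_ (∑[ x ∈ xs ] extend (φ₀ x) as ℤ.* c x)) (∑-neg xs _) ⟩
  (∑[ x ∈ xs ] extend (φ₀ x) as ℤ.* c x) ℤ.- (∑[ x ∈ xs ] extend (φ₁ x) as ℤ.* c x)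
    ≡⟨ cong₂ ℤ._-_ (∑-extend xs φ₀ c as) (∑-extend xs φ₁ c as) ⟩
  extend (λ v → ∑[ x ∈ xs ] φ x v ℤ.* c x) (a ∷ as) ∎
  where
  open ≡-Reasoning
  φ₀ φ₁ : _ → _ → ℤ
  φ₀ x v = φ x (zero ∷ v)
  φ₁ x v = φ x (suc a ∷ v)

-- One-hot encoding with a block of k elements per position. Two codes are disjoint exactly when the
-- words differ at every position, so a single disjointness test performs p letter tests.
code : ∀ {p k} → Vec (Fin k) p → Subset (p ℕ.* k)
code []       = []
code (a ∷ as) = ⁅ a ⁆ ++ code as

∣++∣ : ∀ {m n} (A : Subset m) (B : Subset n) → ∣ A ++ B ∣ ≡ ∣ A ∣ ℕ.+ ∣ B ∣
∣++∣ []            B = refl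
∣++∣ (outside ∷ A) B = ∣++∣ A B
∣++∣ (inside  ∷ A) B = cong suc (∣++∣ A B)

∣code∣ : ∀ {p k} (v : Vec (Fin k) p) → ∣ code v ∣ ≡ p
∣code∣ []       = refl
∣code∣ (a ∷ as) = trans (∣++∣ ⁅ a ⁆ (code as)) (cong₂ ℕ._+_ (∣⁅x⁆∣≡1 a) (∣code∣ as))

_≟ᵛ_ : ∀ {p k} → DecidableEquality (Vec (Fin k) p)
_≟ᵛ_ = Vec.≡-dec Fin._≟_

δ-∷ : ∀ {p k} (c a : Fin k) (cs as : Vec (Fin k) p) →
  δ _≟ᵛ_ (c ∷ cs) (a ∷ as) ≡ δ Fin._≟_ c a ℤ.* δ _≟ᵛ_ cs as
δ-∷ c a cs as = by-cases (c Fin.≟ a)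
  where
  by-cases : Dec (c ≡ a) → δ _≟ᵛ_ (c ∷ cs) (a ∷ as) ≡ δ Fin._≟_ c a ℤ.* δ _≟ᵛ_ cs as
  by-cases (no  c≢a)  = trans (δ-≢ _≟ᵛ_ (c≢a ∘ Vec.∷-injectiveˡ))
    (cong (ℤ._* δ _≟ᵛ_ cs as) (sym (δ-≢ Fin._≟_ c≢a)))
  by-cases (yes refl) = trans (δ-cong _≟ᵛ_ _≟ᵛ_ Vec.∷-injectiveʳ (cong (c ∷_)))
    (trans (sym (ℤ.*-identityˡ _)) (cong (ℤ._* δ _≟ᵛ_ cs as) (sym (δ-≡ Fin._≟_ {c} refl))))

-- [c = a] is [c ≠ *] - [c ≠ a] for the dummy symbol * = 0, coordinatewise.
extend-disjoint : ∀ {m p} (c a : Vec (Fin m) p) →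
  extend (λ v → disjoint (code v) (code (Vec.map suc c))) a ≡ δ _≟ᵛ_ c a
extend-disjoint         []       []       = refl
extend-disjoint {m = m} {p = suc p} (c ∷ cs) (a ∷ as) = begin
  extend (λ v → disjoint (code (zero ∷ v)) (code (suc c ∷ cs′))) as ℤ.-
  extend (λ v → disjoint (code (suc a ∷ v)) (code (suc c ∷ cs′))) as
    ≡⟨ cong₂ ℤ._-_ (first zero) (first (suc a)) ⟩
  δ _≟ᵛ_ cs as ℤ.* disjoint ⁅ zero {m} ⁆ ⁅ suc c ⁆ ℤ.- δ _≟ᵛ_ cs as ℤ.* disjoint ⁅ a ⁆ ⁅ c ⁆
    ≡⟨ cong₂ (λ x y → δ _≟ᵛ_ cs as ℤ.* x ℤ.- δ _≟ᵛ_ cs as ℤ.* y)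
        (disjoint-⊥ˡ ⁅ c ⁆) (disjoint-⁅⁆ a c) ⟩
  δ _≟ᵛ_ cs as ℤ.* 1ℤ ℤ.- δ _≟ᵛ_ cs as ℤ.* (1ℤ ℤ.- δ Fin._≟_ c a)
    ≡⟨ collect (δ _≟ᵛ_ cs as) (δ Fin._≟_ c a) ⟩
  δ Fin._≟_ c a ℤ.* δ _≟ᵛ_ cs as
    ≡⟨ δ-∷ c a cs as ⟨
  δ _≟ᵛ_ (c ∷ cs) (a ∷ as) ∎
  where
  open ≡-Reasoning
  cs′ = Vec.map suc cs
  collect : ∀ x d → x ℤ.* 1ℤ ℤ.- x ℤ.* (1ℤ ℤ.- d) ≡ d ℤ.* x
  collect = solve-∀
  first : ∀ b → extend (λ v → disjoint (code (b ∷ v)) (code (suc c ∷ cs′))) as ≡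
    δ _≟ᵛ_ cs as ℤ.* disjoint ⁅ b ⁆ ⁅ suc c ⁆
  first b = begin
    extend (λ v → disjoint (⁅ b ⁆ ++ code v) (⁅ suc c ⁆ ++ code cs′)) as
      ≡⟨ extend-cong (λ v → trans (disjoint-++ ⁅ b ⁆ ⁅ suc c ⁆ (code v) (code cs′))
          (ℤ.*-comm (disjoint ⁅ b ⁆ ⁅ suc c ⁆) _)) as ⟩
    extend (λ v → disjoint (code v) (code cs′) ℤ.* disjoint ⁅ b ⁆ ⁅ suc c ⁆) as
      ≡⟨ extend-*ʳ _ (disjoint ⁅ b ⁆ ⁅ suc c ⁆) as ⟨
    extend (λ v → disjoint (code v) (code cs′)) as ℤ.* disjoint ⁅ b ⁆ ⁅ suc c ⁆
      ≡⟨ cong (ℤ._* disjoint ⁅ b ⁆ ⁅ suc c ⁆) (extend-disjoint cs as) ⟩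
    δ _≟ᵛ_ cs as ℤ.* disjoint ⁅ b ⁆ ⁅ suc c ⁆ ∎

digits : ∀ {m} p → Fin (m ℕ.^ p) → Vec (Fin m) p
digits         zero    x = []
digits {m = m} (suc p) x = proj₁ (remQuot {m} (m ℕ.^ p) x) ∷ digits p (proj₂ (remQuot {m} (m ℕ.^ p) x))

remQuot-injective : ∀ {n} k {x y : Fin (n ℕ.* k)} → remQuot {n} k x ≡ remQuot {n} k y → x ≡ y
remQuot-injective {n} k {x} {y} eq = trans (sym (Fin.combine-remQuot {n} k x))
  (trans (cong (uncurry combine) eq) (Fin.combine-remQuot {n} k y))

digits-injective : ∀ {m} p {x y : Fin (m ℕ.^ p)} → digits p x ≡ digits p y → x ≡ y
digits-injective zero    {zero} {zero} _ = refl
digits-injective {m = m} (suc p) eq = remQuot-injective {m} (m ℕ.^ p)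
  (cong₂ _,_ (Vec.∷-injectiveˡ eq) (digits-injective p (Vec.∷-injectiveʳ eq)))

-- The matrix multiplication tensor has rank at most r.
record MatMulTensor (N r : ℕ) : Set where
  field
    α β γ   : Fin r → Fin N → Fin N → ℤ
    correct : ∀ i₁ j₁ j₂ k₂ i k →
      (∑[ s ∈ allFin r ] α s i₁ j₁ ℤ.* β s j₂ k₂ ℤ.* γ s i k) ≡
      δ Fin._≟_ i i₁ ℤ.* δ Fin._≟_ j₂ j₁ ℤ.* δ Fin._≟_ k k₂

module _ {m p r : ℕ} where

  private
    w = p ℕ.* suc m

  -- Every index is compared between two of the sets, and exactly one side of each comparison is
  -- extended: i and j in A, k in B, nothing in C. The other side is shifted by `suc`, away from the
  -- dummy letter. The third set is empty in that part and passes its tests there.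
  matMulTensor : TrilinearAlgorithm (w ℕ.+ (w ℕ.+ w)) (p ℕ.+ p) r → MatMulTensor (m ℕ.^ p) r
  matMulTensor T = record
    { α = λ s i j → α′ s (digits p i) (digits p j)
    ; β = λ s j k → β′ s (digits p j) (digits p k)
    ; γ = λ s i k → γ′ s (digits p i) (digits p k)
    ; correct = λ i₁ j₁ j₂ k₂ i k → trans
        (tensor (digits p i₁) (digits p j₁) (digits p j₂) (digits p k₂) (digits p i) (digits p k))
        (cong₂ ℤ._*_ (cong₂ ℤ._*_ (δ-digits i i₁) (δ-digits j₂ j₁)) (δ-digits k k₂))
    }
    where
    open ≡-Reasoning
    open TrilinearAlgorithm T

    δ-digits : ∀ x y → δ _≟ᵛ_ (digits p x) (digits p y) ≡ δ Fin._≟_ x y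
    δ-digits x y = δ-cong _≟ᵛ_ Fin._≟_ (digits-injective p) (cong (digits p))

    ⊥ʷ : Subset w
    ⊥ʷ = ⊥

    -- The three parts of the universe encode the first index of X, the
    -- common index of X and Y, and the second index of Y.
    Aᵢⱼ Bⱼₖ Cᵢₖ : Vec (Fin (suc m)) p → Vec (Fin (suc m)) p → (w ℕ.+ (w ℕ.+ w)) choose (p ℕ.+ p)
    Aᵢⱼ i j = code i ++ code j ++ ⊥ʷ , (begin
      ∣ code i ++ code j ++ ⊥ʷ ∣             ≡⟨ ∣++∣ (code i) _ ⟩
      ∣ code i ∣ ℕ.+ ∣ code j ++ ⊥ʷ ∣        ≡⟨ cong₂ ℕ._+_ (∣code∣ i) (∣++∣ (code j) _) ⟩
      p ℕ.+ (∣ code j ∣ ℕ.+ ∣ ⊥ʷ ∣)          ≡⟨ cong (p ℕ.+_) (cong₂ ℕ._+_ (∣code∣ j) (∣⊥∣≡0 w)) ⟩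
      p ℕ.+ (p ℕ.+ 0)                        ≡⟨ cong (p ℕ.+_) (ℕ.+-identityʳ p) ⟩
      p ℕ.+ p                                ∎)
    Bⱼₖ j k = ⊥ʷ ++ code j ++ code k , (begin
      ∣ ⊥ʷ ++ code j ++ code k ∣             ≡⟨ ∣++∣ ⊥ʷ _ ⟩
      ∣ ⊥ʷ ∣ ℕ.+ ∣ code j ++ code k ∣        ≡⟨ cong₂ ℕ._+_ (∣⊥∣≡0 w) (∣++∣ (code j) _) ⟩
      ∣ code j ∣ ℕ.+ ∣ code k ∣              ≡⟨ cong₂ ℕ._+_ (∣code∣ j) (∣code∣ k) ⟩
      p ℕ.+ p                                ∎)
    Cᵢₖ i k = code i ++ ⊥ʷ ++ code k , (begin
      ∣ code i ++ ⊥ʷ ++ code k ∣             ≡⟨ ∣++∣ (code i) _ ⟩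
      ∣ code i ∣ ℕ.+ ∣ ⊥ʷ ++ code k ∣        ≡⟨ cong₂ ℕ._+_ (∣code∣ i) (∣++∣ ⊥ʷ _) ⟩
      p ℕ.+ (∣ ⊥ʷ ∣ ℕ.+ ∣ code k ∣)          ≡⟨ cong (p ℕ.+_) (cong₂ ℕ._+_ (∣⊥∣≡0 w) (∣code∣ k)) ⟩
      p ℕ.+ p                                ∎)

    α′ β′ γ′ : Fin r → Vec (Fin m) p → Vec (Fin m) p → ℤ
    α′ s i j = extend (λ i′ → extend (λ j′ → coeff s ℤ.* α s (Aᵢⱼ i′ j′)) j) i
    β′ s j k = extend (λ k′ → β s (Bⱼₖ (Vec.map suc j) k′)) k
    γ′ s i k = γ s (Cᵢₖ (Vec.map suc i) (Vec.map suc k))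

    tensor : ∀ i₁ j₁ j₂ k₂ i k →
      (∑[ s ∈ allFin r ] α′ s i₁ j₁ ℤ.* β′ s j₂ k₂ ℤ.* γ′ s i k) ≡
      δ _≟ᵛ_ i i₁ ℤ.* δ _≟ᵛ_ j₂ j₁ ℤ.* δ _≟ᵛ_ k k₂
    tensor i₁ j₁ j₂ k₂ i k = begin
      (∑[ s ∈ allFin r ] α′ s i₁ j₁ ℤ.* β′ s j₂ k₂ ℤ.* γ′ s i k)
        ≡⟨ ∑-cong (allFin r) (λ s → ℤ.*-assoc (α′ s i₁ j₁) _ _) ⟩
      -- The extensions leave the sum one at a time, until only plain sets remain and
      -- `disjoint-tensor` applies. Each then acts on the single factor that contains its word, the
      -- other factors being constants for it.
      (∑[ s ∈ allFin r ] α′ s i₁ j₁ ℤ.* (β′ s j₂ k₂ ℤ.* γ′ s i k))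
        ≡⟨ ∑-extend (allFin r) _ _ i₁ ⟩
      extend (λ i′ → ∑[ s ∈ allFin r ] extend (λ j′ → coeff s ℤ.* α s (Aᵢⱼ i′ j′)) j₁ ℤ.* (β′ s j₂ k₂ ℤ.* γ′ s i k)) i₁
        ≡⟨ extend-cong (λ i′ → ∑-extend (allFin r) _ _ j₁) i₁ ⟩
      extend (λ i′ → extend (λ j′ → ∑[ s ∈ allFin r ] coeff s ℤ.* α s (Aᵢⱼ i′ j′) ℤ.* (β′ s j₂ k₂ ℤ.* γ′ s i k)) j₁) i₁
        ≡⟨ extend-cong (λ i′ → extend-cong (λ j′ → last i′ j′) j₁) i₁ ⟩
      extend (λ i′ → extend (λ j′ → D j′ j₂ ℤ.* (D i′ i ℤ.* δ _≟ᵛ_ k k₂)) j₁) i₁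
        ≡⟨ extend-cong (λ i′ → sym (extend-*ʳ _ _ j₁)) i₁ ⟩
      extend (λ i′ → extend (λ j′ → D j′ j₂) j₁ ℤ.* (D i′ i ℤ.* δ _≟ᵛ_ k k₂)) i₁
        ≡⟨ extend-cong (λ i′ → trans (cong (ℤ._* _) (extend-disjoint j₂ j₁))
            (rotate (δ _≟ᵛ_ j₂ j₁) (D i′ i) _)) i₁ ⟩
      extend (λ i′ → D i′ i ℤ.* (δ _≟ᵛ_ j₂ j₁ ℤ.* δ _≟ᵛ_ k k₂)) i₁
        ≡⟨ extend-*ʳ _ _ i₁ ⟨
      extend (λ i′ → D i′ i) i₁ ℤ.* (δ _≟ᵛ_ j₂ j₁ ℤ.* δ _≟ᵛ_ k k₂)
        ≡⟨ cong (ℤ._* _) (extend-disjoint i i₁) ⟩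
      δ _≟ᵛ_ i i₁ ℤ.* (δ _≟ᵛ_ j₂ j₁ ℤ.* δ _≟ᵛ_ k k₂)
        ≡⟨ ℤ.*-assoc (δ _≟ᵛ_ i i₁) _ _ ⟨
      δ _≟ᵛ_ i i₁ ℤ.* δ _≟ᵛ_ j₂ j₁ ℤ.* δ _≟ᵛ_ k k₂ ∎
      where
      D : Vec (Fin (suc m)) p → Vec (Fin m) p → ℤ
      D v c = disjoint (code v) (code (Vec.map suc c))

      rotate : ∀ x y z → x ℤ.* (y ℤ.* z) ≡ y ℤ.* (x ℤ.* z)
      rotate = solve-∀

      reorder : ∀ x a b c → b ℤ.* (x ℤ.* a ℤ.* c) ≡ x ℤ.* a ℤ.* b ℤ.* c
      reorder = solve-∀

      evaluate : ∀ i′ j′ k′ →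
        (∑[ s ∈ allFin r ] coeff s ℤ.* α s (Aᵢⱼ i′ j′) ℤ.* β s (Bⱼₖ (Vec.map suc j₂) k′) ℤ.* γ′ s i k) ≡
        D k′ k ℤ.* (D j′ j₂ ℤ.* D i′ i)
      evaluate i′ j′ k′ = begin
        _ ≡⟨ disjoint-tensor T (Aᵢⱼ i′ j′) (Bⱼₖ (Vec.map suc j₂) k′) (Cᵢₖ (Vec.map suc i) (Vec.map suc k)) ⟩
        _ ≡⟨ cong₂ ℤ._*_ (cong₂ ℤ._*_ AB AC) BC ⟩
        D j′ j₂ ℤ.* D i′ i ℤ.* D k′ k
          ≡⟨ ℤ.*-comm (D j′ j₂ ℤ.* D i′ i) _ ⟩
        D k′ k ℤ.* (D j′ j₂ ℤ.* D i′ i) ∎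
        where
        split₃ : ∀ (P P′ Q Q′ R R′ : Subset w) →
          disjoint (P ++ Q ++ R) (P′ ++ Q′ ++ R′) ≡ disjoint P P′ ℤ.* (disjoint Q Q′ ℤ.* disjoint R R′)
        split₃ P P′ Q Q′ R R′ = trans (disjoint-++ P P′ _ _) (cong (ℤ._*_ (disjoint P P′)) (disjoint-++ Q Q′ R R′))

        AB : disjoint (code i′ ++ code j′ ++ ⊥ʷ) (⊥ʷ ++ code (Vec.map suc j₂) ++ code k′) ≡ D j′ j₂
        AB = trans (split₃ (code i′) _ (code j′) _ _ _)
          (trans (cong₂ ℤ._*_ (disjoint-⊥ʳ (code i′)) (cong (ℤ._*_ (D j′ j₂)) (disjoint-⊥ˡ (code k′))))
            (trans (ℤ.*-identityˡ _) (ℤ.*-identityʳ _)))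
        AC : disjoint (code i′ ++ code j′ ++ ⊥ʷ) (code (Vec.map suc i) ++ ⊥ʷ ++ code (Vec.map suc k)) ≡ D i′ i
        AC = trans (split₃ (code i′) _ (code j′) _ _ _)
          (trans (cong (ℤ._*_ (D i′ i)) (cong₂ ℤ._*_ (disjoint-⊥ʳ (code j′)) (disjoint-⊥ˡ (code (Vec.map suc k)))))
            (ℤ.*-identityʳ _))
        BC : disjoint (⊥ʷ ++ code (Vec.map suc j₂) ++ code k′) (code (Vec.map suc i) ++ ⊥ʷ ++ code (Vec.map suc k)) ≡ D k′ k
        BC = trans (split₃ ⊥ʷ (code (Vec.map suc i)) (code (Vec.map suc j₂)) _ _ _)
          (trans (cong₂ ℤ._*_ (disjoint-⊥ˡ (code (Vec.map suc i)))
              (cong (ℤ._* D k′ k) (disjoint-⊥ʳ (code (Vec.map suc j₂)))))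
            (trans (ℤ.*-identityˡ _) (ℤ.*-identityˡ _)))

      last : ∀ i′ j′ →
        (∑[ s ∈ allFin r ] coeff s ℤ.* α s (Aᵢⱼ i′ j′) ℤ.* (β′ s j₂ k₂ ℤ.* γ′ s i k)) ≡
        D j′ j₂ ℤ.* (D i′ i ℤ.* δ _≟ᵛ_ k k₂)
      last i′ j′ = begin
        (∑[ s ∈ allFin r ] coeff s ℤ.* α s (Aᵢⱼ i′ j′) ℤ.* (β′ s j₂ k₂ ℤ.* γ′ s i k))
          ≡⟨ ∑-cong (allFin r) (λ s → rotate (coeff s ℤ.* α s (Aᵢⱼ i′ j′)) (β′ s j₂ k₂) _) ⟩
        (∑[ s ∈ allFin r ] β′ s j₂ k₂ ℤ.* (coeff s ℤ.* α s (Aᵢⱼ i′ j′) ℤ.* γ′ s i k))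
          ≡⟨ ∑-extend (allFin r) _ _ k₂ ⟩
        extend (λ k′ → ∑[ s ∈ allFin r ] β s (Bⱼₖ (Vec.map suc j₂) k′) ℤ.* (coeff s ℤ.* α s (Aᵢⱼ i′ j′) ℤ.* γ′ s i k)) k₂
          ≡⟨ extend-cong (λ k′ → trans
              (∑-cong (allFin r) λ s → reorder (coeff s) (α s (Aᵢⱼ i′ j′)) (β s (Bⱼₖ (Vec.map suc j₂) k′)) _)
              (evaluate i′ j′ k′)) k₂ ⟩
        extend (λ k′ → D k′ k ℤ.* (D j′ j₂ ℤ.* D i′ i)) k₂
          ≡⟨ extend-*ʳ _ _ k₂ ⟨
        extend (λ k′ → D k′ k) k₂ ℤ.* (D j′ j₂ ℤ.* D i′ i)
          ≡⟨ cong (ℤ._* (D j′ j₂ ℤ.* D i′ i)) (extend-disjoint k k₂) ⟩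
        δ _≟ᵛ_ k k₂ ℤ.* (D j′ j₂ ℤ.* D i′ i)
          ≡⟨ swap₃ (δ _≟ᵛ_ k k₂) (D j′ j₂) (D i′ i) ⟩
        D j′ j₂ ℤ.* (D i′ i ℤ.* δ _≟ᵛ_ k k₂) ∎
        where
        swap₃ : ∀ x y z → x ℤ.* (y ℤ.* z) ≡ y ℤ.* (z ℤ.* x)
        swap₃ = solve-∀

-- Matrix products from the tensor

pairs : ∀ m n → List (Fin m × Fin n)
pairs m n = cartesianProduct (allFin m) (allFin n)

∑-pairs : ∀ {m n} (f : Fin m → Fin n → ℤ) →
  (∑[ u ∈ pairs m n ] f (proj₁ u) (proj₂ u)) ≡ (∑[ i ∈ allFin m ] ∑[ j ∈ allFin n ] f i j)
∑-pairs {m} {n} f = ∑-cartesianProduct (allFin m) (allFin n) (uncurry f)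

module _ {N r} (T : MatMulTensor N r) where
  open MatMulTensor T
  open ≡-Reasoning

  tensor-multiplies : ∀ (X Y : Fin N → Fin N → ℤ) i k →
    (∑[ s ∈ allFin r ]
      (∑[ u ∈ pairs N N ] α s (proj₁ u) (proj₂ u) ℤ.* X (proj₁ u) (proj₂ u)) ℤ.*
      (∑[ v ∈ pairs N N ] β s (proj₁ v) (proj₂ v) ℤ.* Y (proj₁ v) (proj₂ v)) ℤ.* γ s i k) ≡
    (∑[ j ∈ allFin N ] X i j ℤ.* Y j k)
  tensor-multiplies X Y i k = begin
    (∑[ s ∈ S ] ∑ UU (x s) ℤ.* ∑ UU (y s) ℤ.* γ s i k)
      ≡⟨ ∑-cong S (λ s → trans (cong (ℤ._* γ s i k)
          (trans (ℤ.*-comm (∑ UU (x s)) _) (∑-*-∑ UU UU (y s) (x s))))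
          (trans (∑-*ʳ UU _ (γ s i k)) (∑-cong UU λ v → ∑-*ʳ UU _ (γ s i k)))) ⟩
    -- The sum over v is the outer one because its first component j₂ survives as the summation
    -- index of the product; the three deltas remove j₁, i₁ and k₂.
    (∑[ s ∈ S ] ∑[ v ∈ UU ] ∑[ u ∈ UU ] y s v ℤ.* x s u ℤ.* γ s i k)
      ≡⟨ ∑-swap S UU _ ⟩
    (∑[ v ∈ UU ] ∑[ s ∈ S ] ∑[ u ∈ UU ] y s v ℤ.* x s u ℤ.* γ s i k)
      ≡⟨ ∑-cong UU (λ v → ∑-swap S UU _) ⟩
    (∑[ v ∈ UU ] ∑[ u ∈ UU ] ∑[ s ∈ S ] y s v ℤ.* x s u ℤ.* γ s i k)
      ≡⟨ ∑-cong UU (λ v → ∑-cong UU (collapse v)) ⟩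
    (∑[ v ∈ UU ] ∑[ u ∈ UU ] term (proj₁ u) (proj₂ u) (proj₁ v) (proj₂ v) ℤ.* δ Fin._≟_ (proj₁ v) (proj₂ u))
      ≡⟨ ∑-cong UU (λ v → ∑-pairs λ i₁ j₁ → term i₁ j₁ (proj₁ v) (proj₂ v) ℤ.* δ Fin._≟_ (proj₁ v) j₁) ⟩
    (∑[ v ∈ UU ] ∑[ i₁ ∈ allFin N ] ∑[ j₁ ∈ allFin N ] term i₁ j₁ (proj₁ v) (proj₂ v) ℤ.* δ Fin._≟_ (proj₁ v) j₁)
      ≡⟨ ∑-cong UU (λ v → ∑-cong (allFin N) (λ i₁ → pick (λ j₁ → term i₁ j₁ (proj₁ v) (proj₂ v)) (proj₁ v))) ⟩
    (∑[ v ∈ UU ] ∑[ i₁ ∈ allFin N ] X i₁ (proj₁ v) ℤ.* Y (proj₁ v) (proj₂ v) ℤ.* δ Fin._≟_ k (proj₂ v) ℤ.* δ Fin._≟_ i i₁)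
      ≡⟨ ∑-cong UU (λ v → pick (λ i₁ → X i₁ (proj₁ v) ℤ.* Y (proj₁ v) (proj₂ v) ℤ.* δ Fin._≟_ k (proj₂ v)) i) ⟩
    (∑[ v ∈ UU ] X i (proj₁ v) ℤ.* Y (proj₁ v) (proj₂ v) ℤ.* δ Fin._≟_ k (proj₂ v))
      ≡⟨ ∑-pairs (λ j k₂ → X i j ℤ.* Y j k₂ ℤ.* δ Fin._≟_ k k₂) ⟩
    (∑[ j ∈ allFin N ] ∑[ k₂ ∈ allFin N ] X i j ℤ.* Y j k₂ ℤ.* δ Fin._≟_ k k₂)
      ≡⟨ ∑-cong (allFin N) (λ j → pick (λ k₂ → X i j ℤ.* Y j k₂) k) ⟩
    (∑[ j ∈ allFin N ] X i j ℤ.* Y j k) ∎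
    where
    S = allFin r
    UU = pairs N N
    x y : Fin r → Fin N × Fin N → ℤ
    x s (i , j) = α s i j ℤ.* X i j
    y s (j , k) = β s j k ℤ.* Y j k

    term : Fin N → Fin N → Fin N → Fin N → ℤ
    term i₁ j₁ j₂ k₂ = X i₁ j₁ ℤ.* Y j₂ k₂ ℤ.* δ Fin._≟_ k k₂ ℤ.* δ Fin._≟_ i i₁

    pick : ∀ (f : Fin N → ℤ) a → (∑[ b ∈ allFin N ] f b ℤ.* δ Fin._≟_ a b) ≡ f a
    pick f a = ∑-δ Fin._≟_ f (Unique.allFin⁺ N) (∈-allFin a)

    factor : ∀ a x b y c → (b ℤ.* y) ℤ.* (a ℤ.* x) ℤ.* c ≡ (x ℤ.* y) ℤ.* (a ℤ.* b ℤ.* c)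
    factor = solve-∀

    reorder : ∀ xy d₁ d₂ d₃ → xy ℤ.* (d₁ ℤ.* d₂ ℤ.* d₃) ≡ xy ℤ.* d₃ ℤ.* d₁ ℤ.* d₂
    reorder = solve-∀

    collapse : ∀ v u → (∑[ s ∈ S ] y s v ℤ.* x s u ℤ.* γ s i k) ≡
      term (proj₁ u) (proj₂ u) (proj₁ v) (proj₂ v) ℤ.* δ Fin._≟_ (proj₁ v) (proj₂ u)
    collapse (j₂ , k₂) (i₁ , j₁) = begin
      (∑[ s ∈ S ] y s (j₂ , k₂) ℤ.* x s (i₁ , j₁) ℤ.* γ s i k)
        ≡⟨ ∑-cong S (λ s → factor (α s i₁ j₁) (X i₁ j₁) (β s j₂ k₂) (Y j₂ k₂) (γ s i k)) ⟩
      (∑[ s ∈ S ] (X i₁ j₁ ℤ.* Y j₂ k₂) ℤ.* (α s i₁ j₁ ℤ.* β s j₂ k₂ ℤ.* γ s i k))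
        ≡⟨ ∑-*ˡ S _ (X i₁ j₁ ℤ.* Y j₂ k₂) ⟨
      (X i₁ j₁ ℤ.* Y j₂ k₂) ℤ.* (∑[ s ∈ S ] α s i₁ j₁ ℤ.* β s j₂ k₂ ℤ.* γ s i k)
        ≡⟨ cong (ℤ._*_ (X i₁ j₁ ℤ.* Y j₂ k₂)) (correct i₁ j₁ j₂ k₂ i k) ⟩
      (X i₁ j₁ ℤ.* Y j₂ k₂) ℤ.* (δ Fin._≟_ i i₁ ℤ.* δ Fin._≟_ j₂ j₁ ℤ.* δ Fin._≟_ k k₂)
        ≡⟨ reorder (X i₁ j₁ ℤ.* Y j₂ k₂) (δ Fin._≟_ i i₁) _ _ ⟩
      term i₁ j₁ j₂ k₂ ℤ.* δ Fin._≟_ j₂ j₁ ∎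

-- Building arithmetic programs

-- A program with a hole in place of its remaining steps.
record Prefix (I O : Set) : Set where
  field
    size       : ℕ
    results    : (I → ℤ) → Vec ℤ size
    complete   : Program I O size → Program I O 0
    operations-complete : ∀ (P : Program I O size) →
      operations (complete P) ≡ size ℕ.+ operations P
    runs-complete : ∀ (P : Program I O size) x y → Runs P x (results x) y → Runs (complete P) x [] y

open Prefix

ε : Prefix I O
ε .size = 0
ε .results _ = []
ε .complete P = P
ε .operations-complete P = refl
ε .runs-complete P x y runs = runs

Knows : Prefix I O → ((I → ℤ) → ℤ) → Set
Knows {I} {O} σ f = ∃ λ a → ∀ x → value {I} {O} x (results σ x) a ≡ f x

-- Prefixes are compared by the functions that they can supply, not by their syntax. The renumbering
-- of earlier results caused by a new step thus stays inside `apply`.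
_⊑_ : Prefix I O → Prefix I O → Set
σ ⊑ σ′ = ∀ {f} → Knows σ f → Knows σ′ f

Reaches : Prefix I O → ℕ → (Prefix I O → Set) → Set
Reaches σ c G = ∃ λ σ′ → σ ⊑ σ′ × size σ′ ℕ.≤ size σ ℕ.+ c × G σ′

apply : ∀ op (σ : Prefix I O) {f g h} → Knows σ f → Knows σ g →
  (∀ x → Result op (f x) (g x) (h x)) → Reaches σ 1 (λ σ′ → Knows σ′ h)
apply {I} {O} op σ {f} {g} {h} (a , a-value) (b , b-value) h-result =
  σ′ , weaken-knows , ℕ.≤-reflexive (ℕ.+-comm 1 (size σ)) , (result zero , λ x → refl)
  where
  σ′ : Prefix I O
  σ′ .size = suc (size σ)
  σ′ .results x = h x ∷ results σ x
  σ′ .complete P = complete σ (step op a b P)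
  σ′ .operations-complete P = trans (operations-complete σ (step op a b P))
    (ℕ.+-suc (size σ) (operations P))
  σ′ .runs-complete P x y runs = runs-complete σ (step op a b P) x y
    (h x , subst₂ (λ u v → Result op u v (h x)) (sym (a-value x)) (sym (b-value x)) (h-result x) , runs)

  weaken-knows : σ ⊑ σ′
  weaken-knows (const k  , eq) = const k , eq
  weaken-knows (input i  , eq) = input i , eq
  weaken-knows (result j , eq) = result (suc j) , eq

dot : ∀ (us : List U) (f g : U → (I → ℤ) → ℤ) (σ : Prefix I O) →
  (∀ u → Knows σ (f u)) → (∀ u → Knows σ (g u)) →
  Reaches σ (length us ℕ.* 2) (λ σ′ → Knows σ′ (λ x → ∑[ u ∈ us ] f u x ℤ.* g u x))
dot []       f g σ f-known g-known = σ , id , ℕ.m≤m+n _ _ , (const 0ℤ , λ _ → refl)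
dot (u ∷ us) f g σ f-known g-known =
  let σ₁ , σ⊑σ₁ , size₁ , sum-known = dot us f g σ f-known g-known
      σ₂ , σ₁⊑σ₂ , size₂ , product-known =
        apply mul σ₁ {h = λ x → f u x ℤ.* g u x} (σ⊑σ₁ (f-known u)) (σ⊑σ₁ (g-known u)) (λ _ → refl)
      σ₃ , σ₂⊑σ₃ , size₃ , total-known =
        apply add σ₂ product-known (σ₁⊑σ₂ sum-known) (λ _ → refl)
  in σ₃ , (λ known → σ₂⊑σ₃ (σ₁⊑σ₂ (σ⊑σ₁ known))) , (begin
      size σ₃                                ≤⟨ size₃ ⟩
      size σ₂ ℕ.+ 1                          ≤⟨ ℕ.+-monoˡ-≤ 1 size₂ ⟩
      size σ₁ ℕ.+ 1 ℕ.+ 1                    ≡⟨ ℕ.+-assoc (size σ₁) 1 1 ⟩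
      size σ₁ ℕ.+ 2                          ≤⟨ ℕ.+-monoˡ-≤ 2 size₁ ⟩
      size σ ℕ.+ length us ℕ.* 2 ℕ.+ 2       ≡⟨ ℕ.+-assoc (size σ) _ 2 ⟩
      size σ ℕ.+ (length us ℕ.* 2 ℕ.+ 2)     ≡⟨ cong (size σ ℕ.+_) (ℕ.+-comm _ 2) ⟩
      size σ ℕ.+ length (u ∷ us) ℕ.* 2       ∎) , total-known
  where open ℕ.≤-Reasoning

-- `reach` has to work from every later prefix, because the computation for one element starts where
-- those for the earlier elements ended.
each : ∀ (us : List U) (f : U → (I → ℤ) → ℤ) c (σ : Prefix I O) →
  (∀ u {σ′} → σ ⊑ σ′ → Reaches σ′ c (λ σ″ → Knows σ″ (f u))) →
  Reaches σ (length us ℕ.* c) (λ σ′ → ∀ {u} → u ∈ us → Knows σ′ (f u))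
each []       f c σ reach = σ , id , ℕ.m≤m+n _ _ , λ ()
each (u ∷ us) f c σ reach =
  let σ₁ , σ⊑σ₁ , size₁ , known₁ = reach u {σ} (λ {f} → id)
      σ₂ , σ₁⊑σ₂ , size₂ , known₂ = each us f c σ₁ (λ v {σ′} σ₁⊑σ′ → reach v {σ′} (λ {f} known → σ₁⊑σ′ {f} (σ⊑σ₁ {f} known)))
  in σ₂ , (λ known → σ₁⊑σ₂ (σ⊑σ₁ known)) , (begin
      size σ₂                                ≤⟨ size₂ ⟩
      size σ₁ ℕ.+ length us ℕ.* c            ≤⟨ ℕ.+-monoˡ-≤ _ size₁ ⟩
      size σ ℕ.+ c ℕ.+ length us ℕ.* c       ≡⟨ ℕ.+-assoc (size σ) c _ ⟩
      size σ ℕ.+ length (u ∷ us) ℕ.* c       ∎) ,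
    λ { (here refl) → σ₁⊑σ₂ known₁ ; (there u∈us) → known₂ u∈us }
  where open ℕ.≤-Reasoning

program : ∀ (σ : Prefix I O) (y : O → (I → ℤ) → ℤ) → (∀ o → Knows σ (y o)) →
  ∃ λ P → operations P ≡ size σ × (∀ x → Runs P x [] (λ o → y o x))
program σ y known = complete σ (return (proj₁ ∘ known)) ,
  trans (operations-complete σ (return (proj₁ ∘ known))) (ℕ.+-identityʳ (size σ)) ,
  λ x → runs-complete σ (return (proj₁ ∘ known)) x (λ o → y o x) (λ o → proj₂ (known o) x)

length-× : ∀ (us : List U) {V : Set} (vs : List V) →
  length (cartesianProduct us vs) ≡ length us ℕ.* length vs
length-× []       vs = refl
length-× (u ∷ us) vs = trans (length-++ (map (u ,_) vs))
  (cong₂ ℕ._+_ (length-map (u ,_) vs) (length-× us vs))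

length-allFin : ∀ n → length (allFin n) ≡ n
length-allFin n = length-tabulate {n = n} id

length-pairs : ∀ m n → length (pairs m n) ≡ m ℕ.* n
length-pairs m n = trans (length-× (allFin m) (allFin n))
  (cong₂ ℕ._*_ (length-allFin m) (length-allFin n))

-- Blockwise multiplication

-- An N₁ × N₁ matrix of M × M blocks: the tensor multiplies the block
-- matrices, and the r products of blocks are computed naively.
module _ {N N₁ M r} (T : MatMulTensor N₁ r) (e : Fin N → Fin N₁ × Fin M)
  (e-injective : ∀ {x y} → e x ≡ e y → x ≡ y) where

  open MatMulTensor T

  private
    _≟ᵖ_ : DecidableEquality (Fin N₁ × Fin M)
    _≟ᵖ_ = Product.≡-dec Fin._≟_ Fin._≟_

    image? : ∀ u → Dec (∃ λ I → e I ≡ u)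
    image? u = Fin.any? (λ I → e I ≟ᵖ u)

    Input : Set
    Input = Index N ⊎ Index N

    module _ (tag : Index N → Input) where

      -- Rows and columns outside the image of `e` are filled with zeros, which does not affect the
      -- entries of the product that are read off.
      padded-entry : ∀ {u v} → Dec (∃ λ I → e I ≡ u) → Dec (∃ λ J → e J ≡ v) → (Input → ℤ) → ℤ
      padded-entry (yes (I , _)) (yes (J , _)) x = x (tag (I , J))
      padded-entry (yes _)       (no _)        x = 0ℤ
      padded-entry (no _)        _             x = 0ℤ

      padded : Fin N₁ × Fin M → Fin N₁ × Fin M → (Input → ℤ) → ℤ
      padded u v = padded-entry (image? u) (image? v)

      padded-known : ∀ u v → Knows {Input} {Index N} ε (padded u v)
      padded-known u v with image? u | image? v
      ... | yes (I , _) | yes (J , _) = input (tag (I , J)) , λ _ → refl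
      ... | yes _       | no _        = const 0ℤ , λ _ → refl
      ... | no _        | _           = const 0ℤ , λ _ → refl

      padded-e : ∀ I J x → padded (e I) (e J) x ≡ x (tag (I , J))
      padded-e I J x with image? (e I) | image? (e J)
      ... | yes (I′ , eI) | yes (J′ , eJ) = cong (x ∘ tag) (cong₂ _,_ (e-injective eI) (e-injective eJ))
      ... | no ∉e         | _             = contradiction (I , refl) ∉e
      ... | yes _         | no ∉e         = contradiction (J , refl) ∉e

      padded-outside : ∀ u v x → ¬ (∃ λ J → e J ≡ v) → padded u v x ≡ 0ℤ
      padded-outside u v x v∉e with image? u | image? v
      ... | yes _ | yes v∈e = contradiction v∈e v∉e
      ... | yes _ | no _    = refl
      ... | no _  | _       = refl

    S = allFin r
    products = cartesianProduct S (pairs M M)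

    -- `L` and `R` are the s-th linear forms evaluated on blocks instead of numbers, entry by entry;
    -- `Q` is the naive product of the two resulting blocks.
    L R Q : Fin r × Fin M × Fin M → (Input → ℤ) → ℤ
    L (s , i′ , j′) x = ∑[ u ∈ pairs N₁ N₁ ]
      α s (proj₁ u) (proj₂ u) ℤ.* padded inj₁ (proj₁ u , i′) (proj₂ u , j′) x
    R (s , j′ , k′) x = ∑[ v ∈ pairs N₁ N₁ ]
      β s (proj₁ v) (proj₂ v) ℤ.* padded inj₂ (proj₁ v , j′) (proj₂ v , k′) x
    Q (s , i′ , k′) x = ∑[ j′ ∈ allFin M ] L (s , i′ , j′) x ℤ.* R (s , j′ , k′) x

    Z : Index N → (Input → ℤ) → ℤ
    Z (I , K) x = ∑[ s ∈ S ] Q (s , proj₂ (e I) , proj₂ (e K)) x ℤ.* γ s (proj₁ (e I)) (proj₁ (e K))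

    -- At fixed positions i′, j′, k′ inside the blocks the entries form ordinary N₁ × N₁ matrices,
    -- so the scalar identity `tensor-multiplies` suffices. The remaining sum over (j, j′) is the
    -- sum over the inner index of X and Y, extended by zeros.
    Z-correct : ∀ X Y IK → Z IK (entries X Y) ≡ (X ⊗ Y) IK
    Z-correct X Y (I , K) = begin
      (∑[ s ∈ S ] Q (s , i′ , k′) x ℤ.* γ s i k)
        ≡⟨ ∑-cong S (λ s → ∑-*ʳ (allFin M) _ (γ s i k)) ⟩
      (∑[ s ∈ S ] ∑[ j′ ∈ allFin M ] L (s , i′ , j′) x ℤ.* R (s , j′ , k′) x ℤ.* γ s i k)
        ≡⟨ ∑-swap S (allFin M) _ ⟩
      (∑[ j′ ∈ allFin M ] ∑[ s ∈ S ] L (s , i′ , j′) x ℤ.* R (s , j′ , k′) x ℤ.* γ s i k)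
        ≡⟨ ∑-cong (allFin M) (λ j′ → tensor-multiplies T
            (λ i j → padded inj₁ (i , i′) (j , j′) x) (λ j k → padded inj₂ (j , j′) (k , k′) x) i k) ⟩
      (∑[ j′ ∈ allFin M ] ∑[ j ∈ allFin N₁ ] term (j , j′))
        ≡⟨ ∑-swap (allFin M) (allFin N₁) _ ⟩
      (∑[ j ∈ allFin N₁ ] ∑[ j′ ∈ allFin M ] term (j , j′))
        ≡⟨ ∑-cartesianProduct (allFin N₁) (allFin M) term ⟨
      ∑ (pairs N₁ M) term
        ≡⟨ ∑-embed _≟ᵖ_ e term (Unique.allFin⁺ N)
            (Unique.cartesianProduct⁺ (Unique.allFin⁺ N₁) (Unique.allFin⁺ M))
            ∈-allFin (λ u → ∈-cartesianProduct⁺ (∈-allFin (proj₁ u)) (∈-allFin (proj₂ u)))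
            e-injective image?
            (λ u u∉e → cong (ℤ._* padded inj₂ u (k , k′) x) (padded-outside inj₁ (i , i′) u x u∉e)) ⟩
      (∑[ J ∈ allFin N ] term (e J))
        ≡⟨ ∑-cong (allFin N) (λ J → cong₂ ℤ._*_ (padded-e inj₁ I J x) (padded-e inj₂ J K x)) ⟩
      (X ⊗ Y) (I , K) ∎
      where
      open ≡-Reasoning
      x = entries X Y
      i = proj₁ (e I)
      i′ = proj₂ (e I)
      k = proj₁ (e K)
      k′ = proj₂ (e K)
      term : Fin N₁ × Fin M → ℤ
      term u = padded inj₁ (i , i′) u x ℤ.* padded inj₂ u (k , k′) x

  blockwise-multiplication : ∃ λ P → MultipliesMatrices N P ×
    operations P ℕ.≤
      r ℕ.* (M ℕ.* M) ℕ.* (N₁ ℕ.* N₁ ℕ.* 2) ℕ.+ r ℕ.* (M ℕ.* M) ℕ.* (N₁ ℕ.* N₁ ℕ.* 2) ℕ.+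
      r ℕ.* (M ℕ.* M) ℕ.* (M ℕ.* 2) ℕ.+ N ℕ.* N ℕ.* (r ℕ.* 2)
  blockwise-multiplication =
    let σ₁ , ε⊑σ₁ , size₁ , L-known = each products L _ ε λ { (s , i′ , j′) {σ} ε⊑σ →
          dot (pairs N₁ N₁) (λ u _ → α s (proj₁ u) (proj₂ u)) _ σ
            (λ u → const (α s (proj₁ u) (proj₂ u)) , λ _ → refl)
            (λ u → ε⊑σ (padded-known inj₁ (proj₁ u , i′) (proj₂ u , j′))) }
        σ₂ , σ₁⊑σ₂ , size₂ , R-known = each products R _ σ₁ λ { (s , j′ , k′) {σ} σ₁⊑σ →
          dot (pairs N₁ N₁) (λ u _ → β s (proj₁ u) (proj₂ u)) _ σ
            (λ u → const (β s (proj₁ u) (proj₂ u)) , λ _ → refl)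
            (λ u → σ₁⊑σ (ε⊑σ₁ (padded-known inj₂ (proj₁ u , j′) (proj₂ u , k′)))) }
        σ₃ , σ₂⊑σ₃ , size₃ , Q-known = each products Q _ σ₂ λ { (s , i′ , k′) {σ} σ₂⊑σ →
          dot (allFin M) (λ j′ → L (s , i′ , j′)) (λ j′ → R (s , j′ , k′)) σ
            (λ j′ → σ₂⊑σ {L (s , i′ , j′)} (σ₁⊑σ₂ {L (s , i′ , j′)} (L-known (∈products s i′ j′))))
            (λ j′ → σ₂⊑σ {R (s , j′ , k′)} (R-known (∈products s j′ k′))) }
        σ₄ , σ₃⊑σ₄ , size₄ , Z-known = each (pairs N N) Z _ σ₃ λ { (I , K) {σ} σ₃⊑σ →
          dot S (λ s → Q (s , proj₂ (e I) , proj₂ (e K))) (λ s _ → γ s (proj₁ (e I)) (proj₁ (e K))) σ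
            (λ s → σ₃⊑σ {Q (s , proj₂ (e I) , proj₂ (e K))} (Q-known (∈products s (proj₂ (e I)) (proj₂ (e K)))))
            (λ s → const (γ s (proj₁ (e I)) (proj₁ (e K))) , λ _ → refl) }
        P , operations-P , P-runs = program σ₄ Z (λ { (I , K) → Z-known (∈-cartesianProduct⁺ (∈-allFin I) (∈-allFin K)) })
    in P , (λ X Y → subst-outputs P (Z-correct X Y) (P-runs (entries X Y))) , (begin
        operations P                              ≡⟨ operations-P ⟩
        size σ₄                                   ≤⟨ size₄ ⟩
        size σ₃ ℕ.+ c₄                            ≤⟨ ℕ.+-monoˡ-≤ c₄ size₃ ⟩
        size σ₂ ℕ.+ c₃ ℕ.+ c₄                     ≤⟨ ℕ.+-monoˡ-≤ c₄ (ℕ.+-monoˡ-≤ c₃ size₂) ⟩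
        size σ₁ ℕ.+ c₁ ℕ.+ c₃ ℕ.+ c₄              ≤⟨ ℕ.+-monoˡ-≤ c₄ (ℕ.+-monoˡ-≤ c₃ (ℕ.+-monoˡ-≤ c₁ size₁)) ⟩
        c₁ ℕ.+ c₁ ℕ.+ c₃ ℕ.+ c₄                   ≡⟨ cong₂ ℕ._+_ (cong₂ ℕ._+_ (cong₂ ℕ._+_ c₁-value c₁-value) c₃-value) c₄-value ⟩
        _                                         ∎)
    where
    open ℕ.≤-Reasoning
    c₁ = length products ℕ.* (length (pairs N₁ N₁) ℕ.* 2)
    c₃ = length products ℕ.* (length (allFin M) ℕ.* 2)
    c₄ = length (pairs N N) ℕ.* (length S ℕ.* 2)

    length-products : length products ≡ r ℕ.* (M ℕ.* M)
    length-products = trans (length-× S (pairs M M)) (cong₂ ℕ._*_ (length-allFin r) (length-pairs M M))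
    c₁-value = cong₂ (λ a b → a ℕ.* (b ℕ.* 2)) length-products (length-pairs N₁ N₁)
    c₃-value = cong₂ (λ a b → a ℕ.* (b ℕ.* 2)) length-products (length-allFin M)
    c₄-value = cong₂ (λ a b → a ℕ.* (b ℕ.* 2)) (length-pairs N N) (length-allFin r)

    ∈products : ∀ s i j → (s , i , j) ∈ products
    ∈products s i j = ∈-cartesianProduct⁺ (∈-allFin s) (∈-cartesianProduct⁺ (∈-allFin i) (∈-allFin j))

    -- The outputs are known to agree only pointwise, so the replacement is carried through the
    -- steps down to `return`.
    subst-outputs : ∀ {m} {y y′ : Index N → ℤ} (P : Program Input (Index N) m) → (∀ o → y o ≡ y′ o) →
      ∀ {x ρ} → Runs P x ρ y → Runs P x ρ y′
    subst-outputs (return out)    eq runs = λ o → trans (runs o) (eq o)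
    subst-outputs (step op a b P) eq (v , res , runs) = v , res , subst-outputs P eq runs

-- Powers, roots and the choice of the parameters

^-distribʳ-* : ∀ m n k → (m ℕ.* n) ℕ.^ k ≡ m ℕ.^ k ℕ.* n ℕ.^ k
^-distribʳ-* m n zero    = refl
^-distribʳ-* m n (suc k) = trans (cong (m ℕ.* n ℕ.*_) (^-distribʳ-* m n k)) (interchange m n (m ℕ.^ k) (n ℕ.^ k))
  where
  interchange : ∀ a b c d → a ℕ.* b ℕ.* (c ℕ.* d) ≡ a ℕ.* c ℕ.* (b ℕ.* d)
  interchange = solve-∀ᴺ

^-*-comm : ∀ a m n → (a ℕ.^ m) ℕ.^ n ≡ (a ℕ.^ n) ℕ.^ m
^-*-comm a m n = trans (ℕ.^-*-assoc a m n)
  (trans (cong (a ℕ.^_) (ℕ.*-comm m n)) (sym (ℕ.^-*-assoc a n m)))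

^-cancelˡ-< : ∀ k {m n} → m ℕ.^ k ℕ.< n ℕ.^ k → m ℕ.< n
^-cancelˡ-< k {m} {n} m^k<n^k with m ℕ.<? n
... | yes m<n = m<n
... | no  m≮n = contradiction (ℕ.^-monoˡ-≤ k (ℕ.≮⇒≥ m≮n)) (ℕ.<⇒≱ m^k<n^k)

^-cancelˡ-≤ : ∀ k .{{_ : NonZero k}} {m n} → m ℕ.^ k ℕ.≤ n ℕ.^ k → m ℕ.≤ n
^-cancelˡ-≤ k {m} {n} m^k≤n^k with m ℕ.≤? n
... | yes m≤n = m≤n
... | no  m≰n = contradiction (ℕ.^-monoˡ-< k (ℕ.≰⇒> m≰n)) (ℕ.≤⇒≯ m^k≤n^k)

floor-root : ∀ k .{{_ : NonZero k}} n → ∃ λ m → m ℕ.^ k ℕ.≤ n × n ℕ.< suc m ℕ.^ k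
floor-root k@(suc _) zero = 0 , ℕ.z≤n , ℕ.m^n>0 1 k
floor-root k (suc n) with floor-root k n
... | m , m^k≤n , n<m+1^k with suc m ℕ.^ k ℕ.≤? suc n
...   | yes m+1^k≤n+1 = suc m , m+1^k≤n+1 , ℕ.≤-<-trans n<m+1^k (ℕ.^-monoˡ-< k (ℕ.n<1+n (suc m)))
...   | no  m+1^k≰n+1 = m , ℕ.m≤n⇒m≤1+n m^k≤n , ℕ.≰⇒> m+1^k≰n+1

-- Blocks of size A² balance the naive products of blocks against the linear
-- combinations of blocks.
tensor-cost : ∀ {A r} N → MatMulTensor A r → N ℕ.≤ A ℕ.* (A ℕ.* A) →
  ∃ λ P → MultipliesMatrices N P × operations P ℕ.≤ 8 ℕ.* (r ℕ.* A ℕ.^ 6)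
tensor-cost {A} {r} N T N≤A³ =
  let P , multiplies , cost = blockwise-multiplication T e e-injective
  in P , multiplies , (begin
    operations P
      ≤⟨ cost ⟩
    r ℕ.* (M ℕ.* M) ℕ.* (A ℕ.* A ℕ.* 2) ℕ.+ r ℕ.* (M ℕ.* M) ℕ.* (A ℕ.* A ℕ.* 2) ℕ.+
    r ℕ.* (M ℕ.* M) ℕ.* (M ℕ.* 2) ℕ.+ N ℕ.* N ℕ.* (r ℕ.* 2)
      ≤⟨ ℕ.+-monoʳ-≤ (r ℕ.* (M ℕ.* M) ℕ.* (A ℕ.* A ℕ.* 2) ℕ.+ r ℕ.* (M ℕ.* M) ℕ.* (A ℕ.* A ℕ.* 2) ℕ.+
            r ℕ.* (M ℕ.* M) ℕ.* (M ℕ.* 2)) (ℕ.*-monoˡ-≤ (r ℕ.* 2) (ℕ.*-mono-≤ N≤A³ N≤A³)) ⟩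
    r ℕ.* (M ℕ.* M) ℕ.* (A ℕ.* A ℕ.* 2) ℕ.+ r ℕ.* (M ℕ.* M) ℕ.* (A ℕ.* A ℕ.* 2) ℕ.+
    r ℕ.* (M ℕ.* M) ℕ.* (M ℕ.* 2) ℕ.+ (A ℕ.* M) ℕ.* (A ℕ.* M) ℕ.* (r ℕ.* 2)
      -- Both families of linear forms, the block products and the outputs contribute 2 r A^6 each.
      ≡⟨ total r A ⟩
    8 ℕ.* (r ℕ.* A ℕ.^ 6) ∎)
  where
  open ℕ.≤-Reasoning
  M = A ℕ.* A
  e : Fin N → Fin A × Fin M
  e i = remQuot {A} M (inject≤ i N≤A³)
  e-injective : ∀ {x y} → e x ≡ e y → x ≡ y
  e-injective {x} {y} eq = Fin.inject≤-injective N≤A³ N≤A³ x y (remQuot-injective {A} M eq)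
  total : ∀ r A → r ℕ.* ((A ℕ.* A) ℕ.* (A ℕ.* A)) ℕ.* (A ℕ.* A ℕ.* 2) ℕ.+ r ℕ.* ((A ℕ.* A) ℕ.* (A ℕ.* A)) ℕ.* (A ℕ.* A ℕ.* 2) ℕ.+
    r ℕ.* ((A ℕ.* A) ℕ.* (A ℕ.* A)) ℕ.* ((A ℕ.* A) ℕ.* 2) ℕ.+ (A ℕ.* (A ℕ.* A)) ℕ.* (A ℕ.* (A ℕ.* A)) ℕ.* (r ℕ.* 2) ≡
    8 ℕ.* (r ℕ.* (A ℕ.* (A ℕ.* (A ℕ.* (A ℕ.* (A ℕ.* (A ℕ.* 1)))))))
  total = solve-∀ᴺ

universe : (p m : ℕ) → ℕ
universe p m = p ℕ.* suc m ℕ.+ (p ℕ.* suc m ℕ.+ p ℕ.* suc m)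

m≤universe : ∀ p .{{_ : NonZero p}} m → m ℕ.≤ universe p m
m≤universe p m = begin
  m               ≤⟨ ℕ.n≤1+n m ⟩
  suc m           ≤⟨ ℕ.m≤n*m (suc m) p ⟩
  p ℕ.* suc m     ≤⟨ ℕ.m≤m+n (p ℕ.* suc m) _ ⟩
  universe p m    ∎
  where open ℕ.≤-Reasoning

module _ (g b z C N₀ : ℕ) .{{_ : NonZero g}} .{{_ : NonZero b}}
  (r : ℕ → ℕ) (algorithm : ∀ n → TrilinearAlgorithm n (g ℕ.* b ℕ.+ g ℕ.* b) (r n))
  (r-bound : ∀ n → 1 ℕ.≤ n → N₀ ℕ.≤ n → r n ℕ.≤ C ℕ.* n ℕ.^ (3 ℕ.* g ℕ.* z))
  where

  private
    p d a e K₀ K : ℕ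
    p = g ℕ.* b
    d = p ℕ.* 3
    -- `a / b` is the target exponent w and z / b is w - 2, so `e` equals 3p(w - 2), the exponent of
    -- the rank.
    a = 2 ℕ.* b ℕ.+ z
    e = 3 ℕ.* g ℕ.* z
    -- The 8 is from `tensor-cost`, and (6p)^e pays for n ≤ 6pm. The power of 2 in `K` pays for
    -- rounding the root of N up.
    K₀ = 8 ℕ.* (C ℕ.* (6 ℕ.* p) ℕ.^ e)
    K = K₀ ℕ.* 2 ℕ.^ (3 ℕ.* g ℕ.* a)

    instance
      p≢0 : NonZero p
      p≢0 = ℕ.m*n≢0 g b
      d≢0 : NonZero d
      d≢0 = ℕ.m*n≢0 p 3

    universe≤ : ∀ m → 1 ℕ.≤ m → universe p m ℕ.≤ 6 ℕ.* p ℕ.* m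
    universe≤ m 1≤m = begin
      universe p m                         ≡⟨ lhs p m ⟩
      3 ℕ.* p ℕ.* (1 ℕ.+ m)              ≤⟨ ℕ.*-monoʳ-≤ (3 ℕ.* p) (ℕ.+-monoˡ-≤ m 1≤m) ⟩
      3 ℕ.* p ℕ.* (m ℕ.+ m)              ≡⟨ rhs p m ⟩
      6 ℕ.* p ℕ.* m                      ∎
      where
      open ℕ.≤-Reasoning
      lhs : ∀ p m → p ℕ.* (1 ℕ.+ m) ℕ.+ (p ℕ.* (1 ℕ.+ m) ℕ.+ p ℕ.* (1 ℕ.+ m)) ≡ 3 ℕ.* p ℕ.* (1 ℕ.+ m)
      lhs = solve-∀ᴺ
      rhs : ∀ p m → 3 ℕ.* p ℕ.* (m ℕ.+ m) ≡ 6 ℕ.* p ℕ.* m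
      rhs = solve-∀ᴺ

    cube : ∀ m → (m ℕ.^ p) ℕ.* ((m ℕ.^ p) ℕ.* (m ℕ.^ p)) ≡ m ℕ.^ d
    cube m = trans (cong (λ x → m ℕ.^ p ℕ.* (m ℕ.^ p ℕ.* x)) (sym (ℕ.*-identityʳ (m ℕ.^ p))))
      (ℕ.^-*-assoc m p 3)

    -- The least m with N < m^(3p): rounded up so that the matrix fits, at the price of a factor of
    -- at most 2^d in m^d for N ≥ 1.
    base : ℕ → ℕ
    base N = suc (proj₁ (floor-root d N))

    N≤base^d : ∀ N → N ℕ.≤ base N ℕ.^ d
    N≤base^d N = ℕ.<⇒≤ (proj₂ (proj₂ (floor-root d N)))

    base^d≤ : ∀ N → 1 ℕ.≤ N → base N ℕ.^ d ℕ.≤ 2 ℕ.^ d ℕ.* N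
    base^d≤ N 1≤N with floor-root d N
    ... | m , m^d≤N , N<m+1^d = begin
      suc m ℕ.^ d              ≤⟨ ℕ.^-monoˡ-≤ d (ℕ.+-monoˡ-≤ m 1≤m) ⟩
      (m ℕ.+ m) ℕ.^ d          ≡⟨ cong (λ x → (m ℕ.+ x) ℕ.^ d) (ℕ.+-identityʳ m) ⟨
      (2 ℕ.* m) ℕ.^ d          ≡⟨ ^-distribʳ-* 2 m d ⟩
      2 ℕ.^ d ℕ.* m ℕ.^ d      ≤⟨ ℕ.*-monoʳ-≤ (2 ℕ.^ d) m^d≤N ⟩
      2 ℕ.^ d ℕ.* N            ∎
      where
      open ℕ.≤-Reasoning
      1≤m : 1 ℕ.≤ m
      1≤m = ℕ.≤-pred (^-cancelˡ-< d (ℕ.≤-<-trans (ℕ.≤-trans (ℕ.≤-reflexive (ℕ.^-zeroˡ d)) 1≤N) N<m+1^d))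

  multiplier : ∀ N → ∃ λ P → MultipliesMatrices N P ×
    operations P ℕ.≤ 8 ℕ.* (r (universe p (base N)) ℕ.* (base N ℕ.^ p) ℕ.^ 6)
  multiplier N = tensor-cost N (matMulTensor {base N} {p} (algorithm (universe p (base N))))
    (ℕ.≤-trans (N≤base^d N) (ℕ.≤-reflexive (sym (cube (base N)))))

  multiplier-cost : ∃ λ K → ∃ λ N₁ → ∀ N → 1 ℕ.≤ N → N₁ ℕ.≤ N →
    operations (proj₁ (multiplier N)) ℕ.^ b ℕ.≤ K ℕ.^ b ℕ.* N ℕ.^ (2 ℕ.* b ℕ.+ z)
  -- From N₀^d ≤ N ≤ m^d follows N₀ ≤ m ≤ n, so the rank bound holds at n.
  multiplier-cost = K , N₀ ℕ.^ d , λ N 1≤N N₁≤N →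
    let m = base N
        n = universe p m
        A = m ℕ.^ p
        N₀≤n : N₀ ℕ.≤ n
        N₀≤n = ℕ.≤-trans (^-cancelˡ-≤ d (ℕ.≤-trans N₁≤N (N≤base^d N))) (m≤universe p m)
        1≤n : 1 ℕ.≤ n
        1≤n = ℕ.≤-trans (ℕ.s≤s ℕ.z≤n) (m≤universe p m)
        ops≤ : operations (proj₁ (multiplier N)) ℕ.≤ K₀ ℕ.* m ℕ.^ (3 ℕ.* g ℕ.* a)
        ops≤ = begin
          operations (proj₁ (multiplier N))
            ≤⟨ proj₂ (proj₂ (multiplier N)) ⟩
          8 ℕ.* (r n ℕ.* A ℕ.^ 6)
            ≤⟨ ℕ.*-monoʳ-≤ 8 (ℕ.*-monoˡ-≤ (A ℕ.^ 6) (r-bound n 1≤n N₀≤n)) ⟩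
          8 ℕ.* (C ℕ.* n ℕ.^ e ℕ.* A ℕ.^ 6)
            ≤⟨ ℕ.*-monoʳ-≤ 8 (ℕ.*-monoˡ-≤ (A ℕ.^ 6) (ℕ.*-monoʳ-≤ C (ℕ.^-monoˡ-≤ e (universe≤ m (ℕ.s≤s ℕ.z≤n))))) ⟩
          8 ℕ.* (C ℕ.* (6 ℕ.* p ℕ.* m) ℕ.^ e ℕ.* A ℕ.^ 6)
            ≡⟨ cong (λ x → 8 ℕ.* (C ℕ.* x ℕ.* A ℕ.^ 6)) (^-distribʳ-* (6 ℕ.* p) m e) ⟩
          8 ℕ.* (C ℕ.* ((6 ℕ.* p) ℕ.^ e ℕ.* m ℕ.^ e) ℕ.* A ℕ.^ 6)
            ≡⟨ regroup 8 C ((6 ℕ.* p) ℕ.^ e) (m ℕ.^ e) (A ℕ.^ 6) ⟩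
          K₀ ℕ.* (m ℕ.^ e ℕ.* A ℕ.^ 6)
            ≡⟨ cong (K₀ ℕ.*_) (trans (cong (m ℕ.^ e ℕ.*_) (ℕ.^-*-assoc m p 6)) (sym (ℕ.^-distribˡ-+-* m e (p ℕ.* 6)))) ⟩
          K₀ ℕ.* m ℕ.^ (e ℕ.+ p ℕ.* 6)
            ≡⟨ cong (λ x → K₀ ℕ.* m ℕ.^ x) (exponent g b z) ⟩
          K₀ ℕ.* m ℕ.^ (3 ℕ.* g ℕ.* a) ∎
    in begin
      operations (proj₁ (multiplier N)) ℕ.^ b
        ≤⟨ ℕ.^-monoˡ-≤ b ops≤ ⟩
      (K₀ ℕ.* m ℕ.^ (3 ℕ.* g ℕ.* a)) ℕ.^ b
        ≡⟨ ^-distribʳ-* K₀ _ b ⟩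
      K₀ ℕ.^ b ℕ.* (m ℕ.^ (3 ℕ.* g ℕ.* a)) ℕ.^ b
        ≡⟨ cong (K₀ ℕ.^ b ℕ.*_) (power-of-d m) ⟩
      K₀ ℕ.^ b ℕ.* (m ℕ.^ d) ℕ.^ a
        ≤⟨ ℕ.*-monoʳ-≤ (K₀ ℕ.^ b) (ℕ.^-monoˡ-≤ a (base^d≤ N 1≤N)) ⟩
      K₀ ℕ.^ b ℕ.* (2 ℕ.^ d ℕ.* N) ℕ.^ a
        ≡⟨ cong (K₀ ℕ.^ b ℕ.*_) (trans (^-distribʳ-* (2 ℕ.^ d) N a) (cong (ℕ._* N ℕ.^ a) (sym (power-of-d 2)))) ⟩
      K₀ ℕ.^ b ℕ.* ((2 ℕ.^ (3 ℕ.* g ℕ.* a)) ℕ.^ b ℕ.* N ℕ.^ a)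
        ≡⟨ ℕ.*-assoc (K₀ ℕ.^ b) _ _ ⟨
      K₀ ℕ.^ b ℕ.* (2 ℕ.^ (3 ℕ.* g ℕ.* a)) ℕ.^ b ℕ.* N ℕ.^ a
        ≡⟨ cong (ℕ._* N ℕ.^ a) (^-distribʳ-* K₀ _ b) ⟨
      K ℕ.^ b ℕ.* N ℕ.^ a ∎
    where
    open ℕ.≤-Reasoning
    regroup : ∀ c C x y z → c ℕ.* (C ℕ.* (x ℕ.* y) ℕ.* z) ≡ c ℕ.* (C ℕ.* x) ℕ.* (y ℕ.* z)
    regroup = solve-∀ᴺ
    exponent : ∀ g b z → 3 ℕ.* g ℕ.* z ℕ.+ g ℕ.* b ℕ.* 6 ≡ 3 ℕ.* g ℕ.* (2 ℕ.* b ℕ.+ z)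
    exponent = solve-∀ᴺ
    exponent-d : ∀ g b a → 3 ℕ.* g ℕ.* a ℕ.* b ≡ g ℕ.* b ℕ.* 3 ℕ.* a
    exponent-d = solve-∀ᴺ
    power-of-d : ∀ m → (m ℕ.^ (3 ℕ.* g ℕ.* a)) ℕ.^ b ≡ (m ℕ.^ d) ℕ.^ a
    power-of-d m = trans (ℕ.^-*-assoc m (3 ℕ.* g ℕ.* a) b)
      (trans (cong (m ℕ.^_) (exponent-d g b a)) (sym (ℕ.^-*-assoc m d a)))

-- Rational and real exponents

i/1 : ∀ i → i / 1 ≡ mkℚ i 0 (Coprime.sym (Coprime.1-coprimeTo ℤ.∣ i ∣))
i/1 (+ n)      = ℚ.normalize-coprime _
i/1 -[1+ n ]   = cong ℚ.-_ (ℚ.normalize-coprime {suc n} _)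

/1-+ : ∀ i j → (i ℤ.+ j) / 1 ≡ i / 1 ℚ.+ j / 1
/1-+ i j = ℚ.toℚᵘ-injective (begin
  toℚᵘ ((i ℤ.+ j) / 1)               ≈⟨ ℚ.toℚᵘ-fromℚᵘ (mkℚᵘ (i ℤ.+ j) 0) ⟩
  mkℚᵘ (i ℤ.+ j) 0                   ≈⟨ *≡* (cong (ℤ._* 1ℤ) (sym (cong₂ ℤ._+_ (ℤ.*-identityʳ i) (ℤ.*-identityʳ j)))) ⟩
  mkℚᵘ i 0 ℚᵘ.+ mkℚᵘ j 0             ≈⟨ ℚᵘ.+-cong (ℚ.toℚᵘ-fromℚᵘ (mkℚᵘ i 0)) (ℚ.toℚᵘ-fromℚᵘ (mkℚᵘ j 0)) ⟨
  toℚᵘ (i / 1) ℚᵘ.+ toℚᵘ (j / 1)     ≈⟨ ℚ.toℚᵘ-homo-+ (i / 1) (j / 1) ⟨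
  toℚᵘ (i / 1 ℚ.+ j / 1)             ∎)
  where open ℚᵘ.≃-Reasoning

/1-* : ∀ i j → (i ℤ.* j) / 1 ≡ (i / 1) ℚ.* (j / 1)
/1-* i j = ℚ.toℚᵘ-injective (begin
  toℚᵘ ((i ℤ.* j) / 1)               ≈⟨ ℚ.toℚᵘ-fromℚᵘ (mkℚᵘ (i ℤ.* j) 0) ⟩
  mkℚᵘ i 0 ℚᵘ.* mkℚᵘ j 0             ≈⟨ ℚᵘ.*-cong (ℚ.toℚᵘ-fromℚᵘ (mkℚᵘ i 0)) (ℚ.toℚᵘ-fromℚᵘ (mkℚᵘ j 0)) ⟨
  toℚᵘ (i / 1) ℚᵘ.* toℚᵘ (j / 1)     ≈⟨ ℚ.toℚᵘ-homo-* (i / 1) (j / 1) ⟨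
  toℚᵘ ((i / 1) ℚ.* (j / 1))         ∎)
  where open ℚᵘ.≃-Reasoning

/1-neg : ∀ i → (ℤ.- i) / 1 ≡ ℚ.- (i / 1)
/1-neg i = ℚ.toℚᵘ-injective (begin
  toℚᵘ ((ℤ.- i) / 1)                 ≈⟨ ℚ.toℚᵘ-fromℚᵘ (mkℚᵘ (ℤ.- i) 0) ⟩
  ℚᵘ.- mkℚᵘ i 0                      ≈⟨ ℚᵘ.-‿cong (ℚ.toℚᵘ-fromℚᵘ (mkℚᵘ i 0)) ⟨
  ℚᵘ.- toℚᵘ (i / 1)                  ≈⟨ ℚ.toℚᵘ-homo‿- (i / 1) ⟨
  toℚᵘ (ℚ.- (i / 1))                 ∎)
  where open ℚᵘ.≃-Reasoning

/1-mono-≤ : ∀ {i j} → i ℤ.≤ j → i / 1 ℚ.≤ j / 1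
/1-mono-≤ {i} {j} i≤j = subst₂ ℚ._≤_ (sym (i/1 i)) (sym (i/1 j)) (*≤* (ℤ.*-monoʳ-≤-nonNeg 1ℤ i≤j))

*-↧ : ∀ w → w ℚ.* (↧ w / 1) ≡ ↥ w / 1
*-↧ w@(mkℚ a b-1 _) = ℚ.toℚᵘ-injective (begin
  toℚᵘ (w ℚ.* (↧ w / 1))             ≈⟨ ℚ.toℚᵘ-homo-* w (↧ w / 1) ⟩
  toℚᵘ w ℚᵘ.* toℚᵘ (↧ w / 1)         ≈⟨ ℚᵘ.*-congˡ {toℚᵘ w} (ℚ.toℚᵘ-fromℚᵘ (mkℚᵘ (↧ w) 0)) ⟩
  mkℚᵘ a b-1 ℚᵘ.* mkℚᵘ (↧ w) 0       ≈⟨ *≡* (trans (ℤ.*-identityʳ _) (cong (λ b → a ℤ.* + b) (sym (ℕ.*-identityʳ (suc b-1))))) ⟩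
  mkℚᵘ a 0                           ≈⟨ ℚ.toℚᵘ-fromℚᵘ (mkℚᵘ a 0) ⟨
  toℚᵘ (↥ w / 1)                     ∎)
  where open ℚᵘ.≃-Reasoning

≤∣↥∣ : ∀ q → q ℚ.≤ + ℤ.∣ ↥ q ∣ / 1
≤∣↥∣ q@(mkℚ (+ n) d _) = subst (q ℚ.≤_) (sym (i/1 (+ n)))
  (*≤* (ℤ.*-monoˡ-≤-nonNeg (+ n) (ℤ.+≤+ (ℕ.s≤s ℕ.z≤n))))
≤∣↥∣ q@(mkℚ -[1+ n ] d _) = subst (q ℚ.≤_) (sym (i/1 (+ suc n))) (*≤* ℤ.-≤+)

-- Eventually the sequence stays within 1 of one of its terms, and a rational is at most the
-- absolute value of its numerator. This supplies a natural number in place of c.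
bounded-above : ∀ x → ∃ λ e → ∃ λ N → ∀ n → N ℕ.≤ n → seq x n ℚ.≤ + e / 1
bounded-above x =
  let N , close = cauchy x 1ℚ (ℚ.positive⁻¹ 1ℚ)
      q = seq x N ℚ.+ 1ℚ
  in ℤ.∣ ↥ q ∣ , N , λ n N≤n → begin
    seq x n                                      ≡⟨ split (seq x n) (seq x N) ⟩
    seq x N ℚ.+ (seq x n ℚ.- seq x N)            ≤⟨ ℚ.+-monoʳ-≤ (seq x N) (ℚ.≤-trans (p≤∣p∣ (seq x n ℚ.- seq x N)) (ℚ.<⇒≤ (close n N N≤n ℕ.≤-refl))) ⟩
    q                                            ≤⟨ ≤∣↥∣ q ⟩
    + ℤ.∣ ↥ q ∣ / 1                              ∎
  where
  open ℚ.≤-Reasoning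
  open +-*-Solver
  split : ∀ a b → a ≡ b ℚ.+ (a ℚ.- b)
  split = solve 2 (λ a b → a := b :+ (a :- b)) refl
  p≤∣p∣ : ∀ p → p ℚ.≤ ℚ.∣ p ∣
  p≤∣p∣ p with ℚ.≤-total 0ℚ p
  ... | inj₁ 0≤p = ℚ.≤-reflexive (sym (ℚ.0≤p⇒∣p∣≡p 0≤p))
  ... | inj₂ p≤0 = ℚ.≤-trans p≤0 (ℚ.0≤∣p∣ p)

-- p is a multiple of the denominator b of w, so that the exponent 3p(w - 2) of the
-- rank is an integer, and large enough for 3p(3 - w) to exceed the constant e ≥ c.
module _ (w : ℚ) (e : ℕ) (w<3 : w ℚ.< + 3 / 1) where
  private
    g b p : ℕ
    g = suc e
    b = ↧ₙ w
    p = g ℕ.* b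

    u v : ℚ
    u = + (3 ℕ.* g) / 1
    v = + b / 1

  -- The numerator of w - 2 over the denominator b, so that 3p(w - 2) is 3g times it.
  excess : ℤ
  excess = ↥ w ℤ.- + (2 ℕ.* b)

  private
    3b-a : ℤ
    3b-a = + 3 ℤ.* + b ℤ.- ↥ w

    1≤3b-a : 1ℤ ℤ.≤ 3b-a
    1≤3b-a = begin
      1ℤ                                          ≡⟨ cancel (↥ w) ⟨
      (1ℤ ℤ.+ ↥ w ℤ.* 1ℤ) ℤ.- ↥ w                 ≤⟨ ℤ.+-monoˡ-≤ (ℤ.- ↥ w) (ℤ.i<j⇒suc[i]≤j (ℚ.drop-*<* w<3)) ⟩
      3b-a                                        ∎
      where
      open ℤ.≤-Reasoning
      cancel : ∀ a → (1ℤ ℤ.+ a ℤ.* 1ℤ) ℤ.- a ≡ 1ℤ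
      cancel = solve-∀

    -- As w < 3 has denominator b, 3 - w is at least 1/b; hence 3p(3 - w) ≥ 3g ≥ g = e + 1.
    gap : + g / 1 ℚ.≤ u ℚ.* (+ 3 / 1 ℚ.* v ℚ.- w ℚ.* v)
    gap = ℚ.≤-trans (/1-mono-≤ {+ g} {+ (3 ℕ.* g) ℤ.* 3b-a} integers) (ℚ.≤-reflexive (begin
      (+ (3 ℕ.* g) ℤ.* 3b-a) / 1                  ≡⟨ /1-* (+ (3 ℕ.* g)) 3b-a ⟩
      u ℚ.* (3b-a / 1)                              ≡⟨ cong (u ℚ.*_) (/1-+ (+ 3 ℤ.* + b) (ℤ.- ↥ w)) ⟩
      u ℚ.* ((+ 3 ℤ.* + b) / 1 ℚ.+ (ℤ.- ↥ w) / 1) ≡⟨ cong (u ℚ.*_) (cong₂ ℚ._+_ (/1-* (+ 3) (+ b)) (trans (/1-neg (↥ w)) (cong ℚ.-_ (sym (*-↧ w))))) ⟩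
      u ℚ.* (+ 3 / 1 ℚ.* v ℚ.- w ℚ.* v)           ∎))
      where
      open ≡-Reasoning
      integers : + g ℤ.≤ + (3 ℕ.* g) ℤ.* 3b-a
      integers = ℤ.≤-trans (ℤ.+≤+ (ℕ.m≤m+n g _))
        (ℤ.≤-trans (ℤ.≤-reflexive (sym (ℤ.*-identityʳ (+ (3 ℕ.* g)))))
          (ℤ.*-monoˡ-≤-nonNeg (+ (3 ℕ.* g)) 1≤3b-a))

    target : (+ (3 ℕ.* g) ℤ.* excess) / 1 ≡ u ℚ.* (w ℚ.* v ℚ.- + 2 / 1 ℚ.* v)
    target = begin
      (+ (3 ℕ.* g) ℤ.* excess) / 1                ≡⟨ /1-* (+ (3 ℕ.* g)) excess ⟩
      u ℚ.* (excess / 1)                            ≡⟨ cong (u ℚ.*_) (/1-+ (↥ w) (ℤ.- + (2 ℕ.* b))) ⟩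
      u ℚ.* (↥ w / 1 ℚ.+ (ℤ.- + (2 ℕ.* b)) / 1)   ≡⟨ cong (u ℚ.*_) (cong₂ ℚ._+_ (sym (*-↧ w))
          (trans (/1-neg (+ (2 ℕ.* b))) (cong ℚ.-_ (trans (cong (_/ 1) (ℤ.pos-* 2 b)) (/1-* (+ 2) (+ b)))))) ⟩
      u ℚ.* (w ℚ.* v ℚ.- + 2 / 1 ℚ.* v)           ∎
      where open ≡-Reasoning

    source : + (3 ℕ.* (p ℕ.+ p)) / 1 ≡ u ℚ.* v ℚ.+ u ℚ.* v
    source = begin
      + (3 ℕ.* (p ℕ.+ p)) / 1                     ≡⟨ cong (λ k → + k / 1) (double g b) ⟩
      + (3 ℕ.* g ℕ.* b ℕ.+ 3 ℕ.* g ℕ.* b) / 1     ≡⟨ /1-+ (+ (3 ℕ.* g ℕ.* b)) (+ (3 ℕ.* g ℕ.* b)) ⟩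
      _                                           ≡⟨ cong₂ ℚ._+_ uB uB ⟩
      u ℚ.* v ℚ.+ u ℚ.* v                         ∎
      where
      open ≡-Reasoning
      double : ∀ g b → 3 ℕ.* (g ℕ.* b ℕ.+ g ℕ.* b) ≡ 3 ℕ.* g ℕ.* b ℕ.+ 3 ℕ.* g ℕ.* b
      double g b = trans (ℕ.*-distribˡ-+ 3 (g ℕ.* b) (g ℕ.* b)) (cong₂ ℕ._+_ (sym (ℕ.*-assoc 3 g b)) (sym (ℕ.*-assoc 3 g b)))
      uB : + (3 ℕ.* g ℕ.* b) / 1 ≡ u ℚ.* v
      uB = trans (cong (_/ 1) (ℤ.pos-* (3 ℕ.* g) b)) (/1-* (+ (3 ℕ.* g)) (+ b))

  -- Since -t ≤ w - 3, the first term is at most 6p(w - 5/2), and adding 3p(3 - w) ≥ e + 1 gives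
  -- exactly 3p(w - 2). The summand 1 is the margin that strict inequality of reals requires.
  exponent-bound : ∀ t c → + 3 / 1 ℚ.- t ℚ.≤ w → c ℚ.≤ + e / 1 →
    + (3 ℕ.* (p ℕ.+ p)) / 1 ℚ.* (½ ℚ.- t) ℚ.+ c ℚ.+ 1ℚ ℚ.≤ (+ (3 ℕ.* g) ℤ.* excess) / 1
  exponent-bound t c 3-t≤w c≤e = begin
    + (3 ℕ.* (p ℕ.+ p)) / 1 ℚ.* (½ ℚ.- t) ℚ.+ c ℚ.+ 1ℚ
      ≡⟨ ℚ.+-assoc (+ (3 ℕ.* (p ℕ.+ p)) / 1 ℚ.* (½ ℚ.- t)) c 1ℚ ⟩
    + (3 ℕ.* (p ℕ.+ p)) / 1 ℚ.* (½ ℚ.- t) ℚ.+ (c ℚ.+ 1ℚ)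
      ≤⟨ ℚ.+-mono-≤ (ℚ.*-monoˡ-≤-nonNeg (+ (3 ℕ.* (p ℕ.+ p)) / 1) {{ℚ.nonNegative (/1-mono-≤ {0ℤ} {+ (3 ℕ.* (p ℕ.+ p))} (ℤ.+≤+ ℕ.z≤n))}} ½-t≤)
           (ℚ.≤-trans (ℚ.+-monoˡ-≤ 1ℚ c≤e) (ℚ.≤-trans (ℚ.≤-reflexive e+1) gap)) ⟩
    + (3 ℕ.* (p ℕ.+ p)) / 1 ℚ.* (½ ℚ.+ (w ℚ.- + 3 / 1)) ℚ.+ u ℚ.* (+ 3 / 1 ℚ.* v ℚ.- w ℚ.* v)
      ≡⟨ cong (λ s → s ℚ.* (½ ℚ.+ (w ℚ.- + 3 / 1)) ℚ.+ u ℚ.* (+ 3 / 1 ℚ.* v ℚ.- w ℚ.* v)) source ⟩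
    (u ℚ.* v ℚ.+ u ℚ.* v) ℚ.* (½ ℚ.+ (w ℚ.- + 3 / 1)) ℚ.+ u ℚ.* (+ 3 / 1 ℚ.* v ℚ.- w ℚ.* v)
      ≡⟨ balance u v w ⟩
    u ℚ.* (w ℚ.* v ℚ.- + 2 / 1 ℚ.* v)
      ≡⟨ target ⟨
    (+ (3 ℕ.* g) ℤ.* excess) / 1 ∎
    where
    open ℚ.≤-Reasoning
    open +-*-Solver
    balance : ∀ u v w → (u ℚ.* v ℚ.+ u ℚ.* v) ℚ.* (½ ℚ.+ (w ℚ.- + 3 / 1)) ℚ.+ u ℚ.* (+ 3 / 1 ℚ.* v ℚ.- w ℚ.* v) ≡
      u ℚ.* (w ℚ.* v ℚ.- + 2 / 1 ℚ.* v)
    balance = solve 3 (λ u v w → (u :* v :+ u :* v) :* (con ½ :+ (w :- con (+ 3 / 1))) :+ u :* (con (+ 3 / 1) :* v :- w :* v) :=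
      u :* (w :* v :- con (+ 2 / 1) :* v)) refl
    shift : ∀ t → ℚ.- t ≡ (+ 3 / 1 ℚ.- t) ℚ.- + 3 / 1
    shift = solve 1 (λ t → :- t := (con (+ 3 / 1) :- t) :- con (+ 3 / 1)) refl
    ½-t≤ : ½ ℚ.- t ℚ.≤ ½ ℚ.+ (w ℚ.- + 3 / 1)
    ½-t≤ = ℚ.+-monoʳ-≤ ½ (ℚ.≤-trans (ℚ.≤-reflexive (shift t)) (ℚ.+-monoˡ-≤ (ℚ.- (+ 3 / 1)) 3-t≤w))
    e+1 : + e / 1 ℚ.+ 1ℚ ≡ + g / 1
    e+1 = trans (sym (/1-+ (+ e) 1ℤ)) (cong (λ k → + k / 1) (ℕ.+-comm e 1))

-- Growth bounds and the conclusion

tensor-rank-positive : ∀ {N r} → Fin N → MatMulTensor N r → 1 ℕ.≤ r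
tensor-rank-positive {r = suc r} i T = ℕ.s≤s ℕ.z≤n
tensor-rank-positive {r = zero}  i T = contradiction
  (trans (MatMulTensor.correct T i i i i i i) (cong (λ d → d ℤ.* d ℤ.* d) (δ-≡ Fin._≟_ {i} refl))) λ ()

AtMostPowerℚ-integer : ∀ {a C n} i → AtMostPowerℚ a C n (i / 1) → a ℕ.* n ℕ.^ neg i ℕ.≤ C ℕ.* n ℕ.^ pos i
AtMostPowerℚ-integer {a} {C} {n} i bound =
  subst₂ (λ a C → a ℕ.* n ℕ.^ neg i ℕ.≤ C ℕ.* n ℕ.^ pos i) (ℕ.^-identityʳ a) (ℕ.^-identityʳ C)
    (subst (AtMostPowerℚ a C n) (i/1 i) bound)

-- For a rational y = l/b′ above w = k/b, raising to the power b clears both denominators and leaves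
-- k b′ ≤ l b, which is w < y; n ≥ 1 makes powers monotone in the exponent. A negative y cannot
-- exceed w ≥ 0.
AtMostPower-rational : ∀ {a C n} w k → ↥ w ≡ + k → 1 ℕ.≤ n →
  a ℕ.^ ↧ₙ w ℕ.≤ C ℕ.^ ↧ₙ w ℕ.* n ℕ.^ k → AtMostPower a C n (fromℚ w)
AtMostPower-rational {a} {C} {n} w@(mkℚ _ b-1 _) k refl 1≤n bound y (η , 0<η , M , w+η≤y) =
  power y (ℚ.drop-*<* w<y)
  where
  b = suc b-1
  w<y : w ℚ.< y
  w<y = ℚ.<-≤-trans (subst (ℚ._< w ℚ.+ η) (ℚ.+-identityʳ w) (ℚ.+-monoʳ-< w 0<η)) (w+η≤y M ℕ.≤-refl)

  power : ∀ y → + k ℤ.* ↧ y ℤ.< ↥ y ℤ.* + b → AtMostPowerℚ a C n y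
  power (mkℚ -[1+ l ] b′-1 _) lt = contradiction lt
    (ℤ.≤⇒≯ (ℤ.≤-trans ℤ.-≤+ (ℤ.≤-reflexive (ℤ.pos-* k (suc b′-1)))))
  power (mkℚ (+ l) b′-1 _) lt = ^-cancelˡ-≤ b (begin
    (a ℕ.^ b′ ℕ.* 1) ℕ.^ b                     ≡⟨ cong (ℕ._^ b) (ℕ.*-identityʳ (a ℕ.^ b′)) ⟩
    (a ℕ.^ b′) ℕ.^ b                           ≡⟨ ^-*-comm a b′ b ⟩
    (a ℕ.^ b) ℕ.^ b′                           ≤⟨ ℕ.^-monoˡ-≤ b′ bound ⟩
    (C ℕ.^ b ℕ.* n ℕ.^ k) ℕ.^ b′               ≡⟨ ^-distribʳ-* (C ℕ.^ b) (n ℕ.^ k) b′ ⟩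
    (C ℕ.^ b) ℕ.^ b′ ℕ.* (n ℕ.^ k) ℕ.^ b′      ≡⟨ cong₂ ℕ._*_ (^-*-comm C b b′) (ℕ.^-*-assoc n k b′) ⟩
    (C ℕ.^ b′) ℕ.^ b ℕ.* n ℕ.^ (k ℕ.* b′)      ≤⟨ ℕ.*-monoʳ-≤ ((C ℕ.^ b′) ℕ.^ b) (ℕ.^-monoʳ-≤ n {{ℕ.>-nonZero 1≤n}} kb′≤lb) ⟩
    (C ℕ.^ b′) ℕ.^ b ℕ.* n ℕ.^ (l ℕ.* b)       ≡⟨ cong ((C ℕ.^ b′) ℕ.^ b ℕ.*_) (ℕ.^-*-assoc n l b) ⟨
    (C ℕ.^ b′) ℕ.^ b ℕ.* (n ℕ.^ l) ℕ.^ b       ≡⟨ ^-distribʳ-* (C ℕ.^ b′) (n ℕ.^ l) b ⟨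
    (C ℕ.^ b′ ℕ.* n ℕ.^ l) ℕ.^ b               ∎)
    where
    open ℕ.≤-Reasoning
    b′ = suc b′-1
    kb′≤lb : k ℕ.* b′ ℕ.≤ l ℕ.* b
    kb′≤lb = ℕ.<⇒≤ (ℤ.drop‿+<+ (subst₂ ℤ._<_ (sym (ℤ.pos-* k b′)) (sym (ℤ.pos-* l b)) lt))

matMulExponent : ∀ w k → ↥ w ≡ + k → (program : ∀ N → ∃ λ P → MultipliesMatrices N P) →
  (∃ λ K → ∃ λ N₁ → ∀ N → 1 ℕ.≤ N → N₁ ℕ.≤ N →
    operations (proj₁ (program N)) ℕ.^ ↧ₙ w ℕ.≤ K ℕ.^ ↧ₙ w ℕ.* N ℕ.^ k) →
  MatMulExponent (fromℚ w)
matMulExponent w k w≡ program (K , N₁ , cost) = operations ∘ proj₁ ∘ program ,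
  (K , N₁ , λ N 1≤N N₁≤N → AtMostPower-rational {operations (proj₁ (program N))} {K} w k w≡ 1≤N (cost N 1≤N N₁≤N)) ,
  λ N → proj₁ (program N) , proj₂ (program N) , refl

-- The tensor drawn from the algorithm has an entry 1, whereas an empty sum is 0. So r n ≥ 1, and
-- n^k ≤ C fails once n > C.
rank-bound-contradiction : ∀ p k C N₀ .{{_ : NonZero p}} .{{_ : NonZero k}} (r : ℕ → ℕ) →
  (∀ n → TrilinearAlgorithm n (p ℕ.+ p) (r n)) →
  ¬ (∀ n → 1 ℕ.≤ n → N₀ ℕ.≤ n → r n ℕ.* n ℕ.^ k ℕ.≤ C)
rank-bound-contradiction p k C N₀ r algorithm r-bound = ℕ.<-irrefl refl (begin-strict
  C                      <⟨ ℕ.n<1+n C ⟩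
  suc C                  ≤⟨ ℕ.m≤m+n (suc C) N₀ ⟩
  m                      ≤⟨ m≤universe p m ⟩
  n                      ≡⟨ ℕ.^-identityʳ n ⟨
  n ℕ.^ 1                ≤⟨ ℕ.^-monoʳ-≤ n {{ℕ.>-nonZero 1≤n}} (ℕ.>-nonZero⁻¹ k) ⟩
  n ℕ.^ k                ≡⟨ ℕ.*-identityˡ (n ℕ.^ k) ⟨
  1 ℕ.* n ℕ.^ k          ≤⟨ ℕ.*-monoˡ-≤ (n ℕ.^ k) 1≤r ⟩
  r n ℕ.* n ℕ.^ k        ≤⟨ r-bound n 1≤n (ℕ.≤-trans (ℕ.m≤n+m N₀ (suc C)) (m≤universe p m)) ⟩
  C                      ∎)
  where
  open ℕ.≤-Reasoning
  m = suc C ℕ.+ N₀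
  n = universe p m
  1≤n : 1 ℕ.≤ n
  1≤n = ℕ.≤-trans (ℕ.s≤s ℕ.z≤n) (m≤universe p m)
  1≤r : 1 ℕ.≤ r n
  1≤r = tensor-rank-positive (Fin.fromℕ< (ℕ.m^n>0 m p)) (matMulTensor {m} {p} (algorithm n))

module _ (τ c : ℝ) (hypothesis : ∀ (q : ℕ) → 1 ℕ.≤ q →
    ∃ λ (r : ℕ → ℕ) →
    (∀ n → TrilinearAlgorithm n q (r n)) ×
    r =O[n^ (+ (3 ℕ.* q) / 1) · (fromℚ ½ - τ) + c ]) where

  exponent-≤ : ∀ w → w ℚ.< + 3 / 1 → (∃ λ M → ∀ n → M ℕ.≤ n → + 3 / 1 ℚ.- seq τ n ℚ.≤ w) →
    MatMulExponent (fromℚ w)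
  exponent-≤ w w<3 (M₁ , 3-τ≤w) = by-sign (excess w e w<3) refl
    where
    e = proj₁ (bounded-above c)
    M₂ = proj₁ (proj₂ (bounded-above c))
    b = ↧ₙ w
    g = suc e
    p = g ℕ.* b
    z = (+ (3 ℕ.* g) ℤ.* excess w e w<3) / 1

    r : ℕ → ℕ
    r = proj₁ (hypothesis (p ℕ.+ p) (ℕ.s≤s ℕ.z≤n))
    algorithm = proj₁ (proj₂ (hypothesis (p ℕ.+ p) (ℕ.s≤s ℕ.z≤n)))
    r=O = proj₂ (proj₂ (hypothesis (p ℕ.+ p) (ℕ.s≤s ℕ.z≤n)))
    C = proj₁ r=O
    N₀ = proj₁ (proj₂ r=O)

    r-bound : ∀ n → 1 ℕ.≤ n → N₀ ℕ.≤ n → AtMostPowerℚ (r n) C n z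
    r-bound n 1≤n N₀≤n = proj₂ (proj₂ r=O) n 1≤n N₀≤n z
      -- The margin 1 of `exponent-bound` witnesses that `z` lies strictly above the real exponent
      -- of the hypothesis.
      (1ℚ , ℚ.positive⁻¹ 1ℚ , M₁ ℕ.⊔ M₂ , λ l M≤l → exponent-bound w e w<3 (seq τ l) (seq c l)
        (3-τ≤w l (ℕ.m⊔n≤o⇒m≤o M₁ M₂ M≤l)) (proj₂ (proj₂ (bounded-above c)) l (ℕ.m⊔n≤o⇒n≤o M₁ M₂ M≤l)))

    by-sign : ∀ i → excess w e w<3 ≡ i → MatMulExponent (fromℚ w)
    by-sign (+ k) eq = matMulExponent w (2 ℕ.* b ℕ.+ k) numerator
      (λ N → proj₁ (multiplication N) , proj₁ (proj₂ (multiplication N)))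
      (multiplier-cost g b k C N₀ r algorithm r≤)
      where
      z≡ : z ≡ + (3 ℕ.* g ℕ.* k) / 1
      z≡ = cong (_/ 1) (trans (cong (ℤ._*_ (+ (3 ℕ.* g))) eq) (sym (ℤ.pos-* (3 ℕ.* g) k)))

      r≤ : ∀ n → 1 ℕ.≤ n → N₀ ℕ.≤ n → r n ℕ.≤ C ℕ.* n ℕ.^ (3 ℕ.* g ℕ.* k)
      r≤ n 1≤n N₀≤n = subst (ℕ._≤ C ℕ.* n ℕ.^ (3 ℕ.* g ℕ.* k)) (ℕ.*-identityʳ (r n))
        (AtMostPowerℚ-integer {r n} {C} {n} (+ (3 ℕ.* g ℕ.* k))
          (subst (AtMostPowerℚ (r n) C n) z≡ (r-bound n 1≤n N₀≤n)))

      multiplication = multiplier g b k C N₀ r algorithm r≤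

      numerator : ↥ w ≡ + (2 ℕ.* b ℕ.+ k)
      numerator = trans (add-back (↥ w) (+ (2 ℕ.* b))) (cong (ℤ._+_ (+ (2 ℕ.* b))) eq)
        where
        add-back : ∀ x y → x ≡ y ℤ.+ (x ℤ.- y)
        add-back = solve-∀
    by-sign -[1+ k ] eq = contradiction
      (λ n 1≤n N₀≤n → subst (r n ℕ.* n ℕ.^ (3 ℕ.* g ℕ.* suc k) ℕ.≤_) (ℕ.*-identityʳ C)
        (AtMostPowerℚ-integer {r n} {C} {n} (+ (3 ℕ.* g) ℤ.* -[1+ k ])
          (subst (AtMostPowerℚ (r n) C n) (cong (λ i → (+ (3 ℕ.* g) ℤ.* i) / 1) eq) (r-bound n 1≤n N₀≤n))))
      (rank-bound-contradiction p (3 ℕ.* g ℕ.* suc k) C N₀ r algorithm)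

theorem5 : ∀ (τ c : ℝ) → fromℚ 0ℚ < τ → fromℚ 0ℚ ≤ c →
    (∀ (q : ℕ) → 1 ℕ.≤ q →
    ∃ λ (r : ℕ → ℕ) →
    (∀ n → TrilinearAlgorithm n q (r n)) ×
    r =O[n^ (+ (3 ℕ.* q) / 1) · (fromℚ ½ - τ) + c ]) →
    ω ≤ᵘ upper (fromℚ (+ 3 / 1) - τ)
theorem5 τ c (ε₁ , 0<ε₁ , M₁ , ε₁≤τ) _ hypothesis y (ε₂ , 0<ε₂ , M₂ , 3-τ+ε₂≤y) =
  fromℚ w , exponent-≤ τ c hypothesis w w<3 (M₁ ℕ.⊔ M₂ , 3-τ≤w) , ε₂ , 0<ε₂ , 0 , λ _ _ → w+ε₂≤y
  where
  open ℚ.≤-Reasoning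
  open +-*-Solver
  three = + 3 / 1
  -- Both terms are at least 3 - τ eventually: the first because ε₁ ≤ τ, the second because 3 - τ +
  -- ε₂ ≤ y. The first keeps `w` below 3, the second keeps it below y by ε₂.
  w = (three ℚ.- ε₁) ℚ.⊓ (y ℚ.- ε₂)

  w<3 : w ℚ.< three
  w<3 = begin-strict
    w                   ≤⟨ ℚ.p⊓q≤p (three ℚ.- ε₁) (y ℚ.- ε₂) ⟩
    three ℚ.- ε₁        <⟨ ℚ.+-monoʳ-< three (ℚ.neg-antimono-< 0<ε₁) ⟩
    three               ∎

  w+ε₂≤y : w ℚ.+ ε₂ ℚ.≤ y
  w+ε₂≤y = begin
    w ℚ.+ ε₂            ≤⟨ ℚ.+-monoˡ-≤ ε₂ (ℚ.p⊓q≤q (three ℚ.- ε₁) (y ℚ.- ε₂)) ⟩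
    y ℚ.- ε₂ ℚ.+ ε₂     ≡⟨ solve 2 (λ y ε → y :- ε :+ ε := y) refl y ε₂ ⟩
    y                   ∎

  3-τ≤w : ∀ n → M₁ ℕ.⊔ M₂ ℕ.≤ n → three ℚ.- seq τ n ℚ.≤ w
  3-τ≤w n M≤n = ℚ.⊓-glb
    (ℚ.+-monoʳ-≤ three (ℚ.neg-antimono-≤ (begin
      ε₁                ≡⟨ ℚ.+-identityˡ ε₁ ⟨
      0ℚ ℚ.+ ε₁         ≤⟨ ε₁≤τ n (ℕ.m⊔n≤o⇒m≤o M₁ M₂ M≤n) ⟩
      seq τ n           ∎)))
    (begin
      three ℚ.- seq τ n                    ≡⟨ solve 2 (λ x ε → x := x :+ ε :- ε) refl (three ℚ.- seq τ n) ε₂ ⟩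
      three ℚ.- seq τ n ℚ.+ ε₂ ℚ.- ε₂      ≤⟨ ℚ.+-monoˡ-≤ (ℚ.- ε₂) (3-τ+ε₂≤y n (ℕ.m⊔n≤o⇒n≤o M₁ M₂ M≤n)) ⟩
      y ℚ.- ε₂                             ∎)
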